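{- Let $4.2$ denote the $3$-graph on $4$ vertices with exactly $2$ edges, $K_4^-$ the $3$-graph on $4$ vertices with exactly $3$ edges, $C_5$ the $3$-graph on $\{1,\dots,5\}$ with edges $123,234,345,451,512$, and $F_{3,2}$ the $3$-graph on $\{1,\dots,5\}$ with edges $123,124,125,345$. Then \[\pi_{4.2}(\{K_4^-,C_5,F_{3,2}\})=\frac{4}{9}.\]
   Context: A $3$-graph is a pair $G=(V,E)$ with $E$ a set of $3$-element subsets of $V$. For a $3$-graph $H$ on $h$ vertices and a $3$-graph $G$ on $n\ge h$ vertices, $e_H(G)$ is the number of $h$-subsets of $V(G)$ inducing a subgraph isomorphic to $H$. For a family $\mathcal{F}$ of $3$-graphs, $G$ is $\mathcal{F}$-free if it contains no member of $\mathcal{F}$ as a (not necessarily induced) subgraph. $\mathrm{ex}_H(n,\mathcal{F})$ is the maximum of $e_H(G)$ over $\mathcal{F}$-free $G$ on $n$ vertices, and $\pi_H(\mathcal{F})=\lim_{n\to\infty}\mathrm{ex}_H(n,\mathcal{F})/\binom{n}{h}$ (the limit exists). -}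

module Defs where

open import Data.Bool using (Bool; true; false; _∧_; if_then_else_)
import Data.Bool as B
open import Data.Nat using (ℕ; zero; suc; _≤_; _+_; _*_)
open import Data.Nat.Combinatorics using (_C_)
open import Data.Fin using (Fin; zero; suc)
open import Data.Fin.Subset using (Subset; ⁅_⁆; _∪_; ∣_∣; inside; outside)
open import Data.Fin.Subset.Properties using (_⊆?_)
open import Data.Vec using (_∷_; [])
open import Data.Vec.Properties using (≡-dec)
open import Data.List using (List; []; _∷_; map; _++_; filter; length)
open import Data.Bool.ListAction using (any)
open import Data.Product using (_×_; _,_; ∃-syntax)
open import Data.Empty using (⊥)
open import Relation.Nullary using (¬_; does)
open import Relation.Binary.PropositionalEquality using (_≡_; _≢_)
open import Function.Definitions using (Injective)
import Data.Nat as N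

-- A 3-graph on vertex set Fin n: its edges are exactly the 3-element
-- subsets T with G T ≡ true (values on subsets of other sizes are ignored).
Graph3 : ℕ → Set
Graph3 n = Subset n → Bool

tri : ∀ {n} → Fin n → Fin n → Fin n → Subset n
tri a b c = ⁅ a ⁆ ∪ ⁅ b ⁆ ∪ ⁅ c ⁆

IsEdge : ∀ {n} → Graph3 n → Fin n → Fin n → Fin n → Set
IsEdge G a b c = (a ≢ b) × (a ≢ c) × (b ≢ c) × (G (tri a b c) ≡ true)

Contains : ∀ {n k} → Graph3 n → Graph3 k → Set
Contains {n} {k} G F =
  ∃[ f ] (Injective {A = Fin k} {B = Fin n} _≡_ _≡_ f ×
          (∀ a b c → IsEdge F a b c → IsEdge G (f a) (f b) (f c)))

fromTriples : ∀ {k} → List (Fin k × Fin k × Fin k) → Graph3 k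
fromTriples ts S = any (λ { (a , b , c) → does (≡-dec B._≟_ S (tri a b c)) }) ts

allSubsets : (n : ℕ) → List (Subset n)
allSubsets zero = [] ∷ []
allSubsets (suc n) = map (outside ∷_) (allSubsets n) ++ map (inside ∷_) (allSubsets n)

edgesIn : ∀ {n} → Graph3 n → Subset n → ℕ
edgesIn {n} G S =
  length (filter (λ T → ∣ T ∣ N.≟ 3) (filter (λ T → T ⊆? S) (filter (λ T → G T B.≟ true) (allSubsets n))))

-- e_{4.2}(G): number of 4-subsets of V(G) spanning exactly 2 edges
-- (i.e. inducing a copy of 4.2, the 4-vertex 3-graph with exactly 2 edges)
e42 : ∀ {n} → Graph3 n → ℕ
e42 {n} G =
  length (filter (λ S → edgesIn G S N.≟ 2) (filter (λ S → ∣ S ∣ N.≟ 4) (allSubsets n)))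

v0 v1 v2 v3 v4 : Fin 5
v0 = zero
v1 = suc zero
v2 = suc (suc zero)
v3 = suc (suc (suc zero))
v4 = suc (suc (suc (suc zero)))

w0 w1 w2 w3 : Fin 4
w0 = zero
w1 = suc zero
w2 = suc (suc zero)
w3 = suc (suc (suc zero))

K4⁻ : Graph3 4
K4⁻ = fromTriples ((w0 , w1 , w2) ∷ (w0 , w1 , w3) ∷ (w0 , w2 , w3) ∷ [])

C5 : Graph3 5
C5 = fromTriples ((v0 , v1 , v2) ∷ (v1 , v2 , v3) ∷ (v2 , v3 , v4) ∷ (v3 , v4 , v0) ∷ (v4 , v0 , v1) ∷ [])

F32 : Graph3 5
F32 = fromTriples ((v0 , v1 , v2) ∷ (v0 , v1 , v3) ∷ (v0 , v1 , v4) ∷ (v2 , v3 , v4) ∷ [])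

Free : ∀ {n} → Graph3 n → Set
Free G = ¬ Contains G K4⁻ × ¬ Contains G C5 × ¬ Contains G F32

-- A 4-set with exactly two edges is a pair of edges sharing two vertices, so each copy of 4.2 gives four wedges, i.e.
-- ordered quadruples (x,y,u,v) with edges xyu and xyv.  It suffices that a free graph on n vertices has at most 2n⁴/27
-- wedges, u = v allowed.  This is a flag algebra argument on 6-tuples of vertices.  In each forbidden graph every pair
-- of vertices lies in an edge, so a free graph contains no homomorphic image of it either; hence tuples with repeated
-- vertices behave like injective ones and no error terms arise.  With x_ijk the edge indicators of a 6-tuple, the
-- polynomial 12096 − 163296·x₀₁₂x₀₁₃ minus eight weighted "squares" q(roots, s)·q(roots, t) becomes, after summation
-- over S₆, nonnegative on each of the 24718 labelled free graphs on six vertices.  Summed over all 6-tuples the squares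
-- are nonnegative, which bounds the number of wedges.  The balanced complete tripartite graph attains the bound
-- asymptotically.
module Submission where

open import Defs
open import Data.Nat using (ℕ; suc; _≤_; _+_; _*_)
open import Data.Nat.Combinatorics using (_C_)
open import Data.Product using (_×_; ∃-syntax)

open import Algebra.Bundles using (CommutativeSemigroup)
import Algebra.Properties.CommutativeSemigroup as CommutativeSemigroupProperties
import Algebra.Properties.Semiring.Sum as SemiringSum
open import Algebra.Structures using (IsCommutativeMonoid)
open import Data.Bool as 𝔹 using (Bool; true; false; _∧_; _∨_; if_then_else_)
import Data.Bool.Properties as 𝔹
import Data.Empty as Empty
open import Data.Fin as Fin using (Fin; zero; suc; #_)
import Data.Fin.Properties as Fin
open import Data.Fin.Subset using (Subset; _∈_; _∉_; _⊆_; ⁅_⁆; _∪_; _-_; ∣_∣; inside; outside; ⊤)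
open import Data.Fin.Subset.Properties
open import Data.Integer as ℤ using (ℤ; -[1+_]; 0ℤ; 1ℤ; -1ℤ; +≤+) renaming (+_ to pos)
import Data.Integer.Properties as ℤ
open import Data.List as List using (List; []; _∷_; length; filter)
open import Data.List.Membership.Propositional using () renaming (_∈_ to _∈ˡ_)
open import Data.List.Membership.Propositional.Properties using (∈-filter⁻; ∈-map⁻)
open import Data.List.Relation.Unary.All as All using (All; []; _∷_)
open import Data.List.Relation.Unary.AllPairs using ([]; _∷_)
open import Data.List.Relation.Unary.Any as Any using (Any; here; there)
open import Data.List.Relation.Unary.Unique.Propositional using (Unique)
open import Data.List.Relation.Unary.Unique.Propositional.Properties using (filter⁺; map⁺; ++⁺)
open import Data.Nat as ℕ using (zero; z≤n; s≤s; _^_)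
import Data.Nat.Properties as ℕ
open import Data.Nat.Combinatorics using (nC1≡n; nCk+nC[k+1]≡[n+1]C[k+1]; k>n⇒nCk≡0)
open import Data.Nat.Solver using (module +-*-Solver)
open import Data.Product using (_,_; proj₁; proj₂)
open import Data.Sum using (_⊎_; inj₁; inj₂; [_,_]′)
open import Data.Vec as Vec using (Vec; []; _∷_; lookup)
open import Data.Vec.Base using () renaming (here to hereᵛ; there to thereᵛ)
open import Data.Vec.Properties using (≡-dec; ∷-injectiveʳ)
open import Function using (_∘_; mk⇔)
open import Function.Definitions using (Injective)
open import Relation.Binary.PropositionalEquality hiding ([_])
open import Relation.Nullary using (Dec; yes; no; does; ¬_; contradiction)
open import Relation.Nullary.Decidable using (¬?; _×-dec_; _→-dec_; does-⇔; dec-true; from-yes)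

module ℕ∑ = SemiringSum ℕ.+-*-semiring
module ℤ∑ = SemiringSum ℤ.+-*-semiring

-- Polynomials and disjunctive normal forms in Boolean variables

-- "node l r" stands for l + x·r, where x is the first variable; con a at any depth is a constant.
data Trie (A : Set) : ℕ → Set where
  con  : ∀ {k} → A → Trie A k
  node : ∀ {k} → Trie A k → Trie A k → Trie A (suc k)

low : ∀ {A k} → Trie A (suc k) → Trie A k
low (con a)    = con a
low (node l r) = l

const : ∀ {A k} → Trie A k → A
const (con a)    = a
const (node l r) = const l

-- Abstracting over the monoid serves two uses at once: integers under addition give multilinear
-- polynomials, Booleans under disjunction give disjunctive normal forms.
module TrieSum {A : Set} {_∙_ : A → A → A} {ε : A}
  (isCommutativeMonoid : IsCommutativeMonoid _≡_ _∙_ ε) (_≟ε : ∀ a → Dec (a ≡ ε)) where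

  open IsCommutativeMonoid isCommutativeMonoid using (assoc; comm; identityˡ; identityʳ; isCommutativeSemigroup)

  private
    semigroup : CommutativeSemigroup _ _
    semigroup = record { isCommutativeSemigroup = isCommutativeSemigroup }

    interchange : ∀ a b c d → (a ∙ b) ∙ (c ∙ d) ≡ (a ∙ c) ∙ (b ∙ d)
    interchange = CommutativeSemigroupProperties.interchange semigroup

  infixl 6 _⊕_

  ⟦_⟧ : ∀ {k} → Trie A k → Vec Bool k → A
  ⟦ con a ⟧    _       = a
  ⟦ node l r ⟧ (b ∷ x) = ⟦ l ⟧ x ∙ (if b then ⟦ r ⟧ x else ε)

  _⊕_ : ∀ {k} → Trie A k → Trie A k → Trie A k
  con a    ⊕ con b      = con (a ∙ b)
  con a    ⊕ node l r   = node (con a ⊕ l) r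
  node l r ⊕ con b      = node (l ⊕ con b) r
  node l r ⊕ node l′ r′ = node (l ⊕ l′) (r ⊕ r′)

  high : ∀ {k} → Trie A (suc k) → Trie A k
  high (con a)    = con a
  high (node l r) = l ⊕ r

  conTimes : ∀ {k} → Fin k → A → Trie A k
  conTimes zero    a = node (con ε) (con a)
  conTimes (suc e) a = node (conTimes e a) (con ε)

  _⊙_ : ∀ {k} → Fin k → Trie A k → Trie A k
  -- A zero constant stays a constant, which keeps the tries small.
  e     ⊙ con a    = if does (a ≟ε) then con ε else conTimes e a
  -- Boolean variables are idempotent: x·(l + x·r) = x·(l + r).
  zero  ⊙ node l r = node (con ε) (l ⊕ r)
  suc e ⊙ node l r = node (e ⊙ l) (e ⊙ r)

  subst-vars : ∀ {k m} → Vec (Fin m) k → Trie A k → Trie A m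
  subst-vars σ       (con a)    = con a
  subst-vars (e ∷ σ) (node l r) = subst-vars σ l ⊕ (e ⊙ subst-vars σ r)

  -- For a word σ₁, ..., σₘ the m + 1 summands are the results of applying its prefixes to `p`,
  -- starting with the empty prefix.
  sumOrbit : ∀ {k} → List (Vec (Fin k) k) → Trie A k → Trie A k
  sumOrbit []       p = p
  sumOrbit (σ ∷ σs) p = p ⊕ sumOrbit σs (subst-vars σ p)

  ⟦⟧-⊕ : ∀ {k} (p q : Trie A k) x → ⟦ p ⊕ q ⟧ x ≡ ⟦ p ⟧ x ∙ ⟦ q ⟧ x
  ⟦⟧-⊕ (con a)    (con b)      x       = refl
  ⟦⟧-⊕ (con a)    (node l r)   (b ∷ x) =
    trans (cong (_∙ _) (⟦⟧-⊕ (con a) l x)) (assoc a _ _)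
  ⟦⟧-⊕ (node l r) (con b)      (c ∷ x) = begin
    ⟦ l ⊕ con b ⟧ x ∙ y    ≡⟨ cong (_∙ y) (⟦⟧-⊕ l (con b) x) ⟩
    (⟦ l ⟧ x ∙ b) ∙ y      ≡⟨ assoc _ b y ⟩
    ⟦ l ⟧ x ∙ (b ∙ y)      ≡⟨ cong (⟦ l ⟧ x ∙_) (comm b y) ⟩
    ⟦ l ⟧ x ∙ (y ∙ b)      ≡⟨ assoc _ y b ⟨
    (⟦ l ⟧ x ∙ y) ∙ b      ∎
    where open ≡-Reasoning
          y = if c then ⟦ r ⟧ x else ε
  ⟦⟧-⊕ (node l r) (node l′ r′) (false ∷ x) = begin
    ⟦ l ⊕ l′ ⟧ x ∙ ε                     ≡⟨ cong₂ _∙_ (⟦⟧-⊕ l l′ x) (sym (identityˡ ε)) ⟩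
    (⟦ l ⟧ x ∙ ⟦ l′ ⟧ x) ∙ (ε ∙ ε)       ≡⟨ interchange _ _ ε ε ⟩
    (⟦ l ⟧ x ∙ ε) ∙ (⟦ l′ ⟧ x ∙ ε)       ∎
    where open ≡-Reasoning
  ⟦⟧-⊕ (node l r) (node l′ r′) (true ∷ x) =
    trans (cong₂ _∙_ (⟦⟧-⊕ l l′ x) (⟦⟧-⊕ r r′ x)) (interchange _ _ _ _)

  ⟦⟧-low : ∀ {k} (p : Trie A (suc k)) x → ⟦ low p ⟧ x ≡ ⟦ p ⟧ (false ∷ x)
  ⟦⟧-low (con a)    x = refl
  ⟦⟧-low (node l r) x = sym (identityʳ _)

  ⟦⟧-high : ∀ {k} (p : Trie A (suc k)) x → ⟦ high p ⟧ x ≡ ⟦ p ⟧ (true ∷ x)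
  ⟦⟧-high (con a)    x = refl
  ⟦⟧-high (node l r) x = ⟦⟧-⊕ l r x

  ⟦⟧-conTimes : ∀ {k} (e : Fin k) a x → ⟦ conTimes e a ⟧ x ≡ (if lookup x e then a else ε)
  ⟦⟧-conTimes zero    a (b ∷ x)     = identityˡ _
  ⟦⟧-conTimes (suc e) a (true ∷ x)  = trans (identityʳ _) (⟦⟧-conTimes e a x)
  ⟦⟧-conTimes (suc e) a (false ∷ x) = trans (identityʳ _) (⟦⟧-conTimes e a x)

  private
    if-∙ : ∀ b c {a d} → (if b then a ∙ (if c then d else ε) else ε)
           ≡ (if b then a else ε) ∙ (if c then (if b then d else ε) else ε)
    if-∙ true  c     = refl
    if-∙ false true  = sym (identityˡ ε)
    if-∙ false false = sym (identityˡ ε)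

  ⟦⟧-⊙ : ∀ {k} (e : Fin k) p x → ⟦ e ⊙ p ⟧ x ≡ (if lookup x e then ⟦ p ⟧ x else ε)
  ⟦⟧-⊙ e       (con a)    x with a ≟ε
  ⟦⟧-⊙ e       (con a)    x | yes refl = sym (𝔹.if-eta (lookup x e))
  ⟦⟧-⊙ e       (con a)    x | no _     = ⟦⟧-conTimes e a x
  ⟦⟧-⊙ zero    (node l r) (true ∷ x)  = trans (identityˡ _) (⟦⟧-⊕ l r x)
  ⟦⟧-⊙ zero    (node l r) (false ∷ x) = identityˡ ε
  ⟦⟧-⊙ (suc e) (node l r) (b ∷ x)     = begin
    ⟦ e ⊙ l ⟧ x ∙ (if b then ⟦ e ⊙ r ⟧ x else ε)
      ≡⟨ cong₂ (λ u v → u ∙ (if b then v else ε)) (⟦⟧-⊙ e l x) (⟦⟧-⊙ e r x) ⟩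
    (if lookup x e then ⟦ l ⟧ x else ε) ∙ (if b then (if lookup x e then ⟦ r ⟧ x else ε) else ε)
      ≡⟨ if-∙ (lookup x e) b ⟨
    (if lookup x e then ⟦ l ⟧ x ∙ (if b then ⟦ r ⟧ x else ε) else ε) ∎
    where open ≡-Reasoning

  ⟦⟧-subst-vars : ∀ {k m} (σ : Vec (Fin m) k) p x → ⟦ subst-vars σ p ⟧ x ≡ ⟦ p ⟧ (Vec.map (lookup x) σ)
  ⟦⟧-subst-vars σ       (con a)    x = refl
  ⟦⟧-subst-vars (e ∷ σ) (node l r) x = begin
    ⟦ subst-vars σ l ⊕ (e ⊙ subst-vars σ r) ⟧ x
      ≡⟨ ⟦⟧-⊕ (subst-vars σ l) _ x ⟩
    ⟦ subst-vars σ l ⟧ x ∙ ⟦ e ⊙ subst-vars σ r ⟧ x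
      ≡⟨ cong₂ _∙_ (⟦⟧-subst-vars σ l x) (⟦⟧-⊙ e (subst-vars σ r) x) ⟩
    _ ∙ (if lookup x e then ⟦ subst-vars σ r ⟧ x else ε)
      ≡⟨ cong (λ u → _ ∙ (if lookup x e then u else ε)) (⟦⟧-subst-vars σ r x) ⟩
    _ ∙ (if lookup x e then ⟦ r ⟧ (Vec.map (lookup x) σ) else ε) ∎
    where open ≡-Reasoning

Poly : ℕ → Set
Poly = Trie ℤ

DNF : ℕ → Set
DNF = Trie Bool

open TrieSum ℤ.+-0-isCommutativeMonoid (ℤ._≟ 0ℤ)

module D = TrieSum 𝔹.∨-isCommutativeMonoid (𝔹._≟ false)

scale : ∀ {k} → ℤ → Poly k → Poly k
scale c (con a)    = con (c ℤ.* a)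
scale c (node l r) = node (scale c l) (scale c r)

infixl 7 _⊗_

_⊗_ : ∀ {k} → Poly k → Poly k → Poly k
con a    ⊗ q          = scale a q
node l r ⊗ con b      = scale b (node l r)
-- Since x² = x, the coefficient of x is rl′ + rr′ + lr′.
node l r ⊗ node l′ r′ = node (l ⊗ l′) (r ⊗ (l′ ⊕ r′) ⊕ l ⊗ r′)

isNonNegative : ℤ → Bool
isNonNegative (pos _)  = true
isNonNegative -[1+ _ ] = false

isNonNegativeCon : ∀ {k} → Poly k → Bool
isNonNegativeCon (con a)    = isNonNegative a
isNonNegativeCon (node _ _) = false

-- A decision tree on the variables in order. A branch closes as soon as the edges chosen so far
-- contain a forbidden pattern, which shows as a true constant term of `d`, or as soon as the
-- polynomial is a nonnegative constant.
check : ∀ {k} → Poly k → DNF k → Bool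
check {zero}  p d = const d ∨ isNonNegative (const p)
check {suc k} p d = const d ∨ isNonNegativeCon p ∨ (check (low p) (low d) ∧ check (high p) (D.high d))

-- Soundness of the decision tree and of the polynomial arithmetic

const⇒holds : ∀ {k} (d : DNF k) x → const d ≡ true → D.⟦ d ⟧ x ≡ true
const⇒holds (con _)    x       eq = eq
const⇒holds (node l r) (b ∷ x) eq rewrite const⇒holds l x eq = refl

isNonNegative-sound : ∀ i → isNonNegative i ≡ true → 0ℤ ℤ.≤ i
isNonNegative-sound (pos _) _ = ℤ.+≤+ z≤n

isNonNegativeCon-sound : ∀ {k} (p : Poly k) x → isNonNegativeCon p ≡ true → 0ℤ ℤ.≤ ⟦ p ⟧ x
isNonNegativeCon-sound (con a) _ = isNonNegative-sound a

check-sound : ∀ {k} (p : Poly k) (d : DNF k) → check p d ≡ true →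
              ∀ x → D.⟦ d ⟧ x ≡ false → 0ℤ ℤ.≤ ⟦ p ⟧ x
check-sound {zero}  (con a) d ok [] dx with const d in const-d
... | true  with () ← trans (sym dx) (const⇒holds d [] const-d)
... | false = isNonNegative-sound a ok
check-sound {suc k} p d ok x dx with const d in const-d
... | true  with () ← trans (sym dx) (const⇒holds d x const-d)
... | false with isNonNegativeCon p in p-con
...   | true  = isNonNegativeCon-sound p x p-con
...   | false with check (low p) (low d) in ok-low
check-sound {suc k} p d ok (false ∷ x) dx | false | false | true =
  subst (0ℤ ℤ.≤_) (⟦⟧-low p x)
    (check-sound (low p) (low d) ok-low x (trans (D.⟦⟧-low d x) dx))
check-sound {suc k} p d ok (true ∷ x) dx | false | false | true =
  subst (0ℤ ℤ.≤_) (⟦⟧-high p x)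
    (check-sound (high p) (D.high d) ok x (trans (D.⟦⟧-high d x) dx))

⟦⟧-scale : ∀ {k} c (p : Poly k) x → ⟦ scale c p ⟧ x ≡ c ℤ.* ⟦ p ⟧ x
⟦⟧-scale c (con a)    x = refl
⟦⟧-scale c (node l r) (true ∷ x)  =
  trans (cong₂ ℤ._+_ (⟦⟧-scale c l x) (⟦⟧-scale c r x)) (sym (ℤ.*-distribˡ-+ c _ _))
⟦⟧-scale c (node l r) (false ∷ x) = begin
  ⟦ scale c l ⟧ x ℤ.+ 0ℤ ≡⟨ ℤ.+-identityʳ _ ⟩
  ⟦ scale c l ⟧ x        ≡⟨ ⟦⟧-scale c l x ⟩
  c ℤ.* ⟦ l ⟧ x          ≡⟨ cong (c ℤ.*_) (ℤ.+-identityʳ _) ⟨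
  c ℤ.* (⟦ l ⟧ x ℤ.+ 0ℤ) ∎
  where open ≡-Reasoning

⟦⟧-⊗ : ∀ {k} (p q : Poly k) x → ⟦ p ⊗ q ⟧ x ≡ ⟦ p ⟧ x ℤ.* ⟦ q ⟧ x
⟦⟧-⊗ (con a)    q            x           = ⟦⟧-scale a q x
⟦⟧-⊗ (node l r) (con b)      x           = trans (⟦⟧-scale b (node l r) x) (ℤ.*-comm b _)
⟦⟧-⊗ (node l r) (node l′ r′) (false ∷ x) = begin
  ⟦ l ⊗ l′ ⟧ x ℤ.+ 0ℤ                       ≡⟨ ℤ.+-identityʳ _ ⟩
  ⟦ l ⊗ l′ ⟧ x                              ≡⟨ ⟦⟧-⊗ l l′ x ⟩
  ⟦ l ⟧ x ℤ.* ⟦ l′ ⟧ x                      ≡⟨ cong₂ ℤ._*_ (ℤ.+-identityʳ (⟦ l ⟧ x)) (ℤ.+-identityʳ (⟦ l′ ⟧ x)) ⟨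
  (⟦ l ⟧ x ℤ.+ 0ℤ) ℤ.* (⟦ l′ ⟧ x ℤ.+ 0ℤ)    ∎
  where open ≡-Reasoning
⟦⟧-⊗ (node l r) (node l′ r′) (true ∷ x) = begin
  ⟦ l ⊗ l′ ⟧ x ℤ.+ ⟦ r ⊗ (l′ ⊕ r′) ⊕ l ⊗ r′ ⟧ x
    ≡⟨ cong₂ ℤ._+_ (⟦⟧-⊗ l l′ x) (trans (⟦⟧-⊕ (r ⊗ (l′ ⊕ r′)) (l ⊗ r′) x)
         (cong₂ ℤ._+_ (trans (⟦⟧-⊗ r (l′ ⊕ r′) x) (cong (R ℤ.*_) (⟦⟧-⊕ l′ r′ x))) (⟦⟧-⊗ l r′ x))) ⟩
  L ℤ.* L′ ℤ.+ (R ℤ.* (L′ ℤ.+ R′) ℤ.+ L ℤ.* R′)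
    ≡⟨ cong (ℤ._+_ (L ℤ.* L′)) (ℤ.+-comm (R ℤ.* (L′ ℤ.+ R′)) (L ℤ.* R′)) ⟩
  L ℤ.* L′ ℤ.+ (L ℤ.* R′ ℤ.+ R ℤ.* (L′ ℤ.+ R′))
    ≡⟨ ℤ.+-assoc (L ℤ.* L′) (L ℤ.* R′) (R ℤ.* (L′ ℤ.+ R′)) ⟨
  (L ℤ.* L′ ℤ.+ L ℤ.* R′) ℤ.+ R ℤ.* (L′ ℤ.+ R′)
    ≡⟨ cong (ℤ._+ R ℤ.* (L′ ℤ.+ R′)) (ℤ.*-distribˡ-+ L L′ R′) ⟨
  L ℤ.* (L′ ℤ.+ R′) ℤ.+ R ℤ.* (L′ ℤ.+ R′)
    ≡⟨ ℤ.*-distribʳ-+ (L′ ℤ.+ R′) L R ⟨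
  (L ℤ.+ R) ℤ.* (L′ ℤ.+ R′) ∎
  where open ≡-Reasoning
        L = ⟦ l ⟧ x ; R = ⟦ r ⟧ x ; L′ = ⟦ l′ ⟧ x ; R′ = ⟦ r′ ⟧ x

var : ∀ {k} → Fin k → Poly k
var e = e ⊙ con 1ℤ

infixl 6 _⊝_
infixr 8 _·_

_·_ : ∀ {k} → ℕ → Poly k → Poly k
c · p = scale (pos c) p

_⊝_ : ∀ {k} → Poly k → Poly k → Poly k
p ⊝ q = p ⊕ scale -1ℤ q

-- The flag algebra certificate

-- Triples of positions are numbered colexicographically: 012, 013, 023, 123, 014, 024, 124, 034, …, 345;
-- swapEdges i is the effect of exchanging the positions i and i + 1.
swapEdges : Fin 5 → Vec (Fin 20) 20
swapEdges zero =
  # 0 ∷ # 1 ∷ # 3 ∷ # 2 ∷ # 4 ∷ # 6 ∷ # 5 ∷ # 8 ∷ # 7 ∷ # 9 ∷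
  # 10 ∷ # 12 ∷ # 11 ∷ # 14 ∷ # 13 ∷ # 15 ∷ # 17 ∷ # 16 ∷ # 18 ∷ # 19 ∷ []
swapEdges (suc zero) =
  # 0 ∷ # 2 ∷ # 1 ∷ # 3 ∷ # 5 ∷ # 4 ∷ # 6 ∷ # 7 ∷ # 9 ∷ # 8 ∷
  # 11 ∷ # 10 ∷ # 12 ∷ # 13 ∷ # 15 ∷ # 14 ∷ # 16 ∷ # 18 ∷ # 17 ∷ # 19 ∷ []
swapEdges (suc (suc zero)) =
  # 1 ∷ # 0 ∷ # 2 ∷ # 3 ∷ # 4 ∷ # 7 ∷ # 8 ∷ # 5 ∷ # 6 ∷ # 9 ∷
  # 10 ∷ # 13 ∷ # 14 ∷ # 11 ∷ # 12 ∷ # 15 ∷ # 16 ∷ # 17 ∷ # 19 ∷ # 18 ∷ []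
swapEdges (suc (suc (suc zero))) =
  # 0 ∷ # 4 ∷ # 5 ∷ # 6 ∷ # 1 ∷ # 2 ∷ # 3 ∷ # 7 ∷ # 8 ∷ # 9 ∷
  # 10 ∷ # 11 ∷ # 12 ∷ # 16 ∷ # 17 ∷ # 18 ∷ # 13 ∷ # 14 ∷ # 15 ∷ # 19 ∷ []
swapEdges (suc (suc (suc (suc zero)))) =
  # 0 ∷ # 1 ∷ # 2 ∷ # 3 ∷ # 10 ∷ # 11 ∷ # 12 ∷ # 13 ∷ # 14 ∷ # 15 ∷
  # 4 ∷ # 5 ∷ # 6 ∷ # 7 ∷ # 8 ∷ # 9 ∷ # 16 ∷ # 17 ∷ # 18 ∷ # 19 ∷ []

-- The weights and coefficients are a rounded solution of a semidefinite program.  The roots are x and y; u and v are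
-- the two further vertices.  In the limit of the balanced complete tripartite graph each entry sums to 0 over u and v.
pairSquares : List (ℕ × Poly 4)
pairSquares =
  (53217 , 3 · (xyu ⊗ (xuv ⊝ yuv)) ⊝ 2 · (xuv ⊝ yuv)) ∷
  (20655 , xyu ⊗ (xuv ⊝ yuv) ⊕ (xuv ⊝ yuv)) ∷
  (432 , con (pos 4) ⊝ 9 · e ⊕ 27 · xyu ⊝ 27 · d² ⊝ 18 · D ⊕ 18 · c) ∷
  (36 , con (pos 8) ⊝ 9 · e ⊝ 54 · d² ⊝ 36 · c) ∷
  (180 , con (pos 4) ⊝ 6 · e ⊕ 9 · xyu ⊝ 27 · d² ⊝ 6 · D ⊝ 6 · c) ∷ []
  where
  xyu = var (# 0) ; xyv = var (# 1) ; xuv = var (# 2) ; yuv = var (# 3)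
  D  = xuv ⊕ yuv
  c  = xuv ⊗ yuv
  d² = xyu ⊗ xyv
  e  = xyu ⊗ D

-- The roots form a wedge xyu, xyv, and w is the further vertex; all entries are antisymmetric in u and v.
edgePairSquares : List (ℕ × Poly 6)
edgePairSquares =
  (125712 , (con (pos 2) ⊝ uvw) ⊗ (xuw ⊕ yuw ⊝ xvw ⊝ yvw)) ∷
  (282528 , (con (pos 1) ⊝ uvw) ⊗ a ⊝ 2 · b) ∷
  (29808 , 2 · a ⊕ b) ∷ []
  where
  xuw = var (# 1) ; yuw = var (# 2) ; xvw = var (# 3) ; yvw = var (# 4) ; uvw = var (# 5)
  a = xuw ⊝ xvw ⊝ yuw ⊕ yvw
  b = xuw ⊗ yvw ⊝ xvw ⊗ yuw

-- 4, 10, 16, 17 are the triples 014, 015, 045, 145.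
pairSquare : ℕ × Poly 4 → Poly 20
pairSquare (w , q) = w · (subst-vars (# 0 ∷ # 1 ∷ # 2 ∷ # 3 ∷ []) q ⊗ subst-vars (# 4 ∷ # 10 ∷ # 16 ∷ # 17 ∷ []) q)

-- The factor x₀₁₂x₀₁₃ makes the roots 0, 1, 2, 3 a wedge. The variables 4 to 9 are the triples of
-- two roots with position 4, and 10 to 15 those with position 5.
edgePairSquare : ℕ × Poly 6 → Poly 20
edgePairSquare (w , q) = w · (var (# 0) ⊗ var (# 1) ⊗
  (subst-vars (# 4 ∷ # 5 ∷ # 6 ∷ # 7 ∷ # 8 ∷ # 9 ∷ []) q
    ⊗ subst-vars (# 10 ∷ # 11 ∷ # 12 ∷ # 13 ∷ # 14 ∷ # 15 ∷ []) q))

∑ᴾ : ∀ {A : Set} {k} → (A → Poly k) → List A → Poly k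
∑ᴾ f = List.foldr (λ a p → f a ⊕ p) (con 0ℤ)

-- Here 12096 = 2·6048 and 163296 = 27·6048, so a nonnegative sum of `target` says that the wedge
-- density is at most 2/27. This is the limiting density in the balanced complete tripartite graph:
-- 2/3 for the choice of x and y, and 1/9 for u and v in the third part.
target squares : Poly 20
target  = con (pos 12096) ⊝ 163296 · (var (# 0) ⊗ var (# 1))
squares = ∑ᴾ pairSquare pairSquares ⊕ ∑ᴾ edgePairSquare edgePairSquares

-- The prefixes of the k-th word in adjacent transpositions represent S_{k+1} modulo S_k, so summing along all words in
-- turn symmetrises over S₆.
cosets : List (List (Fin 5))
cosets = (# 0 ∷ []) ∷ (# 1 ∷ # 0 ∷ []) ∷ (# 2 ∷ # 1 ∷ # 0 ∷ []) ∷ (# 3 ∷ # 2 ∷ # 1 ∷ # 0 ∷ [])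
  ∷ (# 4 ∷ # 3 ∷ # 2 ∷ # 1 ∷ # 0 ∷ []) ∷ []

symmetrise : ∀ {A : Set} → (List (Vec (Fin 20) 20) → A → A) → List (List (Fin 5)) → A → A
symmetrise f []         a = a
symmetrise f (is ∷ iss) a = symmetrise f iss (f (List.map swapEdges is) a)

monomial : List (Fin 20) → DNF 20
monomial = List.foldr D._⊙_ (con true)

K4⁻-edges C5-edges F32-edges : List (Fin 20)
K4⁻-edges = # 0 ∷ # 1 ∷ # 2 ∷ []
C5-edges  = # 0 ∷ # 3 ∷ # 9 ∷ # 7 ∷ # 4 ∷ []
F32-edges = # 0 ∷ # 1 ∷ # 4 ∷ # 9 ∷ []

forbidden : DNF 20
forbidden = monomial K4⁻-edges D.⊕ (monomial C5-edges D.⊕ monomial F32-edges)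

certificate-nonneg : ∀ x → D.⟦ symmetrise D.sumOrbit cosets forbidden ⟧ x ≡ false →
                     0ℤ ℤ.≤ ⟦ symmetrise sumOrbit cosets (target ⊝ squares) ⟧ x
certificate-nonneg =
  -- Here `refl` runs the whole case split over the 20 edge variables during type checking.
  check-sound (symmetrise sumOrbit cosets (target ⊝ squares)) (symmetrise D.sumOrbit cosets forbidden) refl

-- Sums over tuples of vertices

swapAt : ∀ {A : Set} {m} → Fin m → Vec A (suc m) → Vec A (suc m)
swapAt zero    (a ∷ b ∷ t) = b ∷ a ∷ t
swapAt (suc i) (a ∷ t)     = a ∷ swapAt i t

sum-nonneg : ∀ {n} (g : Fin n → ℤ) → (∀ i → 0ℤ ℤ.≤ g i) → 0ℤ ℤ.≤ ℤ∑.sum g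
sum-nonneg {zero}  g g≥0 = ℤ.≤-refl
sum-nonneg {suc n} g g≥0 = ℤ.+-mono-≤ (g≥0 zero) (sum-nonneg (g ∘ suc) (g≥0 ∘ suc))

sum-const : ∀ n c → ℤ∑.sum {n} (λ _ → c) ≡ pos n ℤ.* c
sum-const zero    c = refl
sum-const (suc n) c = trans (cong (ℤ._+_ c) (sum-const n c)) (sym (ℤ.suc-* (pos n) c))

0≤i*i : ∀ i → 0ℤ ℤ.≤ i ℤ.* i
0≤i*i (pos zero)    = +≤+ z≤n
0≤i*i (pos (suc n)) = +≤+ z≤n
0≤i*i -[1+ n ]      = +≤+ z≤n

0≤i*j : ∀ {i j} → 0ℤ ℤ.≤ i → 0ℤ ℤ.≤ j → 0ℤ ℤ.≤ i ℤ.* j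
0≤i*j {pos i} {pos j} _ _ = subst (0ℤ ℤ.≤_) (ℤ.pos-* i j) (+≤+ z≤n)

module TupleSum {n : ℕ} where

  ∑ᵛ : ∀ m → (Vec (Fin n) m → ℤ) → ℤ
  ∑ᵛ zero    F = F []
  ∑ᵛ (suc m) F = ℤ∑.sum λ x → ∑ᵛ m (F ∘ (x ∷_))

  ∑ᵛ-cong : ∀ m {F G} → (∀ t → F t ≡ G t) → ∑ᵛ m F ≡ ∑ᵛ m G
  ∑ᵛ-cong zero    F≡G = F≡G []
  ∑ᵛ-cong (suc m) F≡G = ℤ∑.sum-cong-≗ λ x → ∑ᵛ-cong m (F≡G ∘ (x ∷_))

  ∑ᵛ-+ : ∀ m F G → ∑ᵛ m (λ t → F t ℤ.+ G t) ≡ ∑ᵛ m F ℤ.+ ∑ᵛ m G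
  ∑ᵛ-+ zero    F G = refl
  ∑ᵛ-+ (suc m) F G = trans (ℤ∑.sum-cong-≗ λ x → ∑ᵛ-+ m (F ∘ (x ∷_)) (G ∘ (x ∷_)))
    (ℤ∑.∑-distrib-+ (λ x → ∑ᵛ m (F ∘ (x ∷_))) (λ x → ∑ᵛ m (G ∘ (x ∷_))))

  ∑ᵛ-* : ∀ m c F → ∑ᵛ m (λ t → c ℤ.* F t) ≡ c ℤ.* ∑ᵛ m F
  ∑ᵛ-* zero    c F = refl
  ∑ᵛ-* (suc m) c F = trans (ℤ∑.sum-cong-≗ λ x → ∑ᵛ-* m c (F ∘ (x ∷_)))
    (sym (ℤ∑.*-distribˡ-sum c λ x → ∑ᵛ m (F ∘ (x ∷_))))

  ∑ᵛ-nonneg : ∀ m F → (∀ t → 0ℤ ℤ.≤ F t) → 0ℤ ℤ.≤ ∑ᵛ m F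
  ∑ᵛ-nonneg zero    F F≥0 = F≥0 []
  ∑ᵛ-nonneg (suc m) F F≥0 = sum-nonneg _ λ x → ∑ᵛ-nonneg m (F ∘ (x ∷_)) (F≥0 ∘ (x ∷_))

  ∑ᵛ-const : ∀ m c → ∑ᵛ m (λ _ → c) ≡ pos (n ^ m) ℤ.* c
  ∑ᵛ-const zero    c = sym (ℤ.*-identityˡ c)
  ∑ᵛ-const (suc m) c = begin
    ℤ∑.sum {n} (λ x → ∑ᵛ m (λ _ → c)) ≡⟨ sum-const n _ ⟩
    pos n ℤ.* ∑ᵛ m (λ _ → c)         ≡⟨ cong (pos n ℤ.*_) (∑ᵛ-const m c) ⟩
    pos n ℤ.* (pos (n ^ m) ℤ.* c)      ≡⟨ ℤ.*-assoc (pos n) (pos (n ^ m)) c ⟨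
    pos n ℤ.* pos (n ^ m) ℤ.* c        ≡⟨ cong (ℤ._* c) (ℤ.pos-* n (n ^ m)) ⟨
    pos (n ^ suc m) ℤ.* c            ∎
    where open ≡-Reasoning

  ∑ᵛ-swapAt : ∀ {m} (i : Fin m) F → ∑ᵛ (suc m) (F ∘ swapAt i) ≡ ∑ᵛ (suc m) F
  ∑ᵛ-swapAt {suc m} zero    F = ℤ∑.∑-comm λ x y → ∑ᵛ m (λ t → F (y ∷ x ∷ t))
  ∑ᵛ-swapAt {suc m} (suc i) F = ℤ∑.sum-cong-≗ λ x → ∑ᵛ-swapAt i (F ∘ (x ∷_))

  -- The tuples `s` and `t` range independently, repetitions included, so the double sum is exactly
  -- c·(∑F)².
  ∑ᵛ-square-nonneg : ∀ m {c} F → 0ℤ ℤ.≤ c → 0ℤ ℤ.≤ ∑ᵛ m (λ s → ∑ᵛ m (λ t → c ℤ.* (F s ℤ.* F t)))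
  ∑ᵛ-square-nonneg m {c} F c≥0 = subst (0ℤ ℤ.≤_) (sym square) (0≤i*j c≥0 (0≤i*i (∑ᵛ m F)))
    where
    open ≡-Reasoning
    square : ∑ᵛ m (λ s → ∑ᵛ m (λ t → c ℤ.* (F s ℤ.* F t))) ≡ c ℤ.* (∑ᵛ m F ℤ.* ∑ᵛ m F)
    square = begin
      ∑ᵛ m (λ s → ∑ᵛ m (λ t → c ℤ.* (F s ℤ.* F t)))
        ≡⟨ ∑ᵛ-cong m (λ s → trans (∑ᵛ-* m c _) (cong (c ℤ.*_) (∑ᵛ-* m (F s) F))) ⟩
      ∑ᵛ m (λ s → c ℤ.* (F s ℤ.* ∑ᵛ m F))
        ≡⟨ ∑ᵛ-* m c _ ⟩
      c ℤ.* ∑ᵛ m (λ s → F s ℤ.* ∑ᵛ m F)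
        ≡⟨ cong (c ℤ.*_) (trans (∑ᵛ-cong m (λ s → ℤ.*-comm (F s) (∑ᵛ m F))) (∑ᵛ-* m (∑ᵛ m F) F)) ⟩
      c ℤ.* (∑ᵛ m F ℤ.* ∑ᵛ m F) ∎

-- Summing the certificate over all 6-tuples of vertices

module Certificate {n : ℕ} (f : Fin n → Fin n → Fin n → Bool)
  (f-swap₁₂ : ∀ a b c → f a b c ≡ f b a c) (f-swap₂₃ : ∀ a b c → f a b c ≡ f a c b) where

  open TupleSum {n}

  edges : Vec (Fin n) 6 → Vec Bool 20
  edges (a ∷ b ∷ c ∷ d ∷ e ∷ g ∷ []) =
    f a b c ∷ f a b d ∷ f a c d ∷ f b c d ∷
    f a b e ∷ f a c e ∷ f b c e ∷ f a d e ∷ f b d e ∷ f c d e ∷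
    f a b g ∷ f a c g ∷ f b c g ∷ f a d g ∷ f b d g ∷ f c d g ∷
    f a e g ∷ f b e g ∷ f c e g ∷ f d e g ∷ []

  -- Only the four triples containing both exchanged positions need the symmetry of `f`; the others
  -- are fixed or change places as they stand.
  edges-swapAt : ∀ i t → edges (swapAt i t) ≡ Vec.map (lookup (edges t)) (swapEdges i)
  edges-swapAt zero (a ∷ b ∷ c ∷ d ∷ e ∷ g ∷ [])
    rewrite f-swap₁₂ a b c | f-swap₁₂ a b d | f-swap₁₂ a b e | f-swap₁₂ a b g = refl
  edges-swapAt (suc zero) (a ∷ b ∷ c ∷ d ∷ e ∷ g ∷ [])
    rewrite f-swap₂₃ a b c | f-swap₁₂ b c d | f-swap₁₂ b c e | f-swap₁₂ b c g = refl
  edges-swapAt (suc (suc zero)) (a ∷ b ∷ c ∷ d ∷ e ∷ g ∷ [])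
    rewrite f-swap₂₃ a c d | f-swap₂₃ b c d | f-swap₁₂ c d e | f-swap₁₂ c d g = refl
  edges-swapAt (suc (suc (suc zero))) (a ∷ b ∷ c ∷ d ∷ e ∷ g ∷ [])
    rewrite f-swap₂₃ a d e | f-swap₂₃ b d e | f-swap₂₃ c d e | f-swap₁₂ d e g = refl
  edges-swapAt (suc (suc (suc (suc zero)))) (a ∷ b ∷ c ∷ d ∷ e ∷ g ∷ [])
    rewrite f-swap₂₃ a e g | f-swap₂₃ b e g | f-swap₂₃ c e g | f-swap₂₃ d e g = refl

  total : Poly 20 → ℤ
  total p = ∑ᵛ 6 (⟦ p ⟧ ∘ edges)

  total-⊕ : ∀ p q → total (p ⊕ q) ≡ total p ℤ.+ total q
  total-⊕ p q = trans (∑ᵛ-cong 6 (⟦⟧-⊕ p q ∘ edges)) (∑ᵛ-+ 6 (⟦ p ⟧ ∘ edges) (⟦ q ⟧ ∘ edges))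

  total-scale : ∀ c p → total (scale c p) ≡ c ℤ.* total p
  total-scale c p = trans (∑ᵛ-cong 6 (⟦⟧-scale c p ∘ edges)) (∑ᵛ-* 6 c (⟦ p ⟧ ∘ edges))

  total-⊝ : ∀ p q → total (p ⊝ q) ≡ total p ℤ.- total q
  total-⊝ p q = trans (total-⊕ p (scale -1ℤ q))
    (cong (ℤ._+_ (total p)) (trans (total-scale -1ℤ q) (ℤ.-1*i≡-i (total q))))

  total-swap : ∀ i p → total (subst-vars (swapEdges i) p) ≡ total p
  total-swap i p = trans
    (∑ᵛ-cong 6 λ t → trans (⟦⟧-subst-vars (swapEdges i) p (edges t)) (cong ⟦ p ⟧ (sym (edges-swapAt i t))))
    (∑ᵛ-swapAt i (⟦ p ⟧ ∘ edges))

  total-sumOrbit : ∀ is p → total (sumOrbit (List.map swapEdges is) p) ≡ pos (suc (length is)) ℤ.* total p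
  total-sumOrbit []       p = sym (ℤ.*-identityˡ (total p))
  total-sumOrbit (i ∷ is) p = begin
    total (p ⊕ sumOrbit (List.map swapEdges is) (subst-vars (swapEdges i) p))
      ≡⟨ total-⊕ p _ ⟩
    total p ℤ.+ total (sumOrbit (List.map swapEdges is) (subst-vars (swapEdges i) p))
      ≡⟨ cong (ℤ._+_ (total p)) (trans (total-sumOrbit is _) (cong (pos (suc (length is)) ℤ.*_) (total-swap i p))) ⟩
    total p ℤ.+ pos (suc (length is)) ℤ.* total p
      ≡⟨ ℤ.suc-* (pos (suc (length is))) (total p) ⟨
    pos (suc (suc (length is))) ℤ.* total p ∎
    where open ≡-Reasoning

  -- Totals are invariant under exchanging positions, so each stage multiplies the total by the
  -- number of prefixes of its word, a positive factor that cancels.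
  total-symmetrise-nonneg : ∀ iss p → 0ℤ ℤ.≤ total (symmetrise sumOrbit iss p) → 0ℤ ℤ.≤ total p
  total-symmetrise-nonneg []         p h = h
  total-symmetrise-nonneg (is ∷ iss) p h =
    ℤ.*-cancelˡ-≤-pos 0ℤ (total p) (pos (suc (length is)))
      (subst₂ ℤ._≤_ (sym (ℤ.*-zeroʳ (pos (suc (length is))))) (total-sumOrbit is p)
        (total-symmetrise-nonneg iss (sumOrbit (List.map swapEdges is) p) h))

  -- Being a record rather than a bare function type, it lets unification read off `d` without
  -- evaluating the formula.
  record Avoids (d : DNF 20) : Set where
    constructor avoiding
    field misses : ∀ t → D.⟦ d ⟧ (edges t) ≡ false

  open Avoids

  avoids-⊕ : ∀ {d d′} → Avoids d → Avoids d′ → Avoids (d D.⊕ d′)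
  avoids-⊕ {d} {d′} h h′ .misses t = trans (D.⟦⟧-⊕ d d′ (edges t)) (cong₂ _∨_ (h .misses t) (h′ .misses t))

  -- `misses` speaks of all tuples, and a relabelled pattern at `t` is the original pattern at the
  -- tuple with two positions exchanged.
  avoids-sumOrbit : ∀ is {d} → Avoids d → Avoids (D.sumOrbit (List.map swapEdges is) d)
  avoids-sumOrbit []           h = h
  avoids-sumOrbit (i ∷ is) {d} h = avoids-⊕ h (avoids-sumOrbit is (avoiding λ t →
    trans (D.⟦⟧-subst-vars (swapEdges i) d (edges t))
      (trans (cong D.⟦ d ⟧ (sym (edges-swapAt i t))) (h .misses (swapAt i t)))))

  avoids-symmetrise : ∀ iss {d} → Avoids d → Avoids (symmetrise D.sumOrbit iss d)
  avoids-symmetrise []         h = h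
  avoids-symmetrise (is ∷ iss) h = avoids-symmetrise iss (avoids-sumOrbit is h)

  indicator : Bool → ℤ
  indicator b = if b then 1ℤ else 0ℤ

  indicator-nonneg : ∀ b → 0ℤ ℤ.≤ indicator b
  indicator-nonneg true  = +≤+ z≤n
  indicator-nonneg false = +≤+ z≤n

  ⟦⟧-var : ∀ {k} (e : Fin k) x → ⟦ var e ⟧ x ≡ indicator (lookup x e)
  ⟦⟧-var e x = ⟦⟧-⊙ e (con 1ℤ) x

  pairSquare-value : ∀ w q x y u v s t → ⟦ pairSquare (w , q) ⟧ (edges (x ∷ y ∷ u ∷ v ∷ s ∷ t ∷ []))
    ≡ pos w ℤ.* (⟦ q ⟧ (f x y u ∷ f x y v ∷ f x u v ∷ f y u v ∷ [])
               ℤ.* ⟦ q ⟧ (f x y s ∷ f x y t ∷ f x s t ∷ f y s t ∷ []))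
  pairSquare-value w q x y u v s t =
    trans (⟦⟧-scale (pos w) (q₁ ⊗ q₂) z) (cong (pos w ℤ.*_) (trans (⟦⟧-⊗ q₁ q₂ z)
      (cong₂ ℤ._*_ (⟦⟧-subst-vars (# 0 ∷ # 1 ∷ # 2 ∷ # 3 ∷ []) q z)
                   (⟦⟧-subst-vars (# 4 ∷ # 10 ∷ # 16 ∷ # 17 ∷ []) q z))))
    where
    z  = edges (x ∷ y ∷ u ∷ v ∷ s ∷ t ∷ [])
    q₁ = subst-vars (# 0 ∷ # 1 ∷ # 2 ∷ # 3 ∷ []) q
    q₂ = subst-vars (# 4 ∷ # 10 ∷ # 16 ∷ # 17 ∷ []) q

  -- For fixed roots x and y the sum over the pairs (u, v) and (s, t) is a weighted square.
  total-pairSquare-nonneg : ∀ wq → 0ℤ ℤ.≤ total (pairSquare wq)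
  total-pairSquare-nonneg (w , q) = sum-nonneg _ λ x → sum-nonneg _ λ y → subst (0ℤ ℤ.≤_)
    (ℤ∑.sum-cong-≗ λ u → ℤ∑.sum-cong-≗ λ v → ℤ∑.sum-cong-≗ λ s → ℤ∑.sum-cong-≗ λ t →
      sym (pairSquare-value w q x y u v s t))
    (∑ᵛ-square-nonneg 2 {pos w} (λ { (u ∷ v ∷ []) → ⟦ q ⟧ (f x y u ∷ f x y v ∷ f x u v ∷ f y u v ∷ []) }) (+≤+ z≤n))

  wedge : Fin n → Fin n → Fin n → Fin n → ℤ
  wedge x y u v = indicator (f x y u) ℤ.* indicator (f x y v)

  wedge-value : ∀ x y u v t → ⟦ var (# 0) ⊗ var (# 1) ⟧ (edges (x ∷ y ∷ u ∷ v ∷ t)) ≡ wedge x y u v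
  wedge-value x y u v t@(_ ∷ _ ∷ []) =
    trans (⟦⟧-⊗ (var (# 0)) (var (# 1)) z) (cong₂ ℤ._*_ (⟦⟧-var (# 0) z) (⟦⟧-var (# 1) z))
    where z = edges (x ∷ y ∷ u ∷ v ∷ t)

  wedge-nonneg : ∀ x y u v → 0ℤ ℤ.≤ wedge x y u v
  wedge-nonneg x y u v = 0≤i*j (indicator-nonneg (f x y u)) (indicator-nonneg (f x y v))

  edgePairSquare-value : ∀ w q x y u v s t → ⟦ edgePairSquare (w , q) ⟧ (edges (x ∷ y ∷ u ∷ v ∷ s ∷ t ∷ []))
    ≡ (pos w ℤ.* wedge x y u v) ℤ.* (⟦ q ⟧ (f x y s ∷ f x u s ∷ f y u s ∷ f x v s ∷ f y v s ∷ f u v s ∷ [])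
                                   ℤ.* ⟦ q ⟧ (f x y t ∷ f x u t ∷ f y u t ∷ f x v t ∷ f y v t ∷ f u v t ∷ []))
  edgePairSquare-value w q x y u v s t =
    trans (⟦⟧-scale (pos w) (r ⊗ (q₁ ⊗ q₂)) z) (trans
      (cong (pos w ℤ.*_) (trans (⟦⟧-⊗ r (q₁ ⊗ q₂) z) (cong₂ ℤ._*_ (wedge-value x y u v (s ∷ t ∷ []))
        (trans (⟦⟧-⊗ q₁ q₂ z)
          (cong₂ ℤ._*_ (⟦⟧-subst-vars (# 4 ∷ # 5 ∷ # 6 ∷ # 7 ∷ # 8 ∷ # 9 ∷ []) q z)
                       (⟦⟧-subst-vars (# 10 ∷ # 11 ∷ # 12 ∷ # 13 ∷ # 14 ∷ # 15 ∷ []) q z))))))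
      (sym (ℤ.*-assoc (pos w) (wedge x y u v) _)))
    where
    z  = edges (x ∷ y ∷ u ∷ v ∷ s ∷ t ∷ [])
    r  = var (# 0) ⊗ var (# 1)
    q₁ = subst-vars (# 4 ∷ # 5 ∷ # 6 ∷ # 7 ∷ # 8 ∷ # 9 ∷ []) q
    q₂ = subst-vars (# 10 ∷ # 11 ∷ # 12 ∷ # 13 ∷ # 14 ∷ # 15 ∷ []) q

  -- For fixed roots x, y, u, v the sum over s and t is a square, weighted by the nonnegative number
  -- w·`wedge x y u v`.
  total-edgePairSquare-nonneg : ∀ wq → 0ℤ ℤ.≤ total (edgePairSquare wq)
  total-edgePairSquare-nonneg (w , q) =
    sum-nonneg _ λ x → sum-nonneg _ λ y → sum-nonneg _ λ u → sum-nonneg _ λ v → subst (0ℤ ℤ.≤_)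
      (ℤ∑.sum-cong-≗ λ s → ℤ∑.sum-cong-≗ λ t → sym (edgePairSquare-value w q x y u v s t))
      (∑ᵛ-square-nonneg 1 {pos w ℤ.* wedge x y u v}
        (λ { (s ∷ []) → ⟦ q ⟧ (f x y s ∷ f x u s ∷ f y u s ∷ f x v s ∷ f y v s ∷ f u v s ∷ []) })
        (0≤i*j {pos w} (+≤+ z≤n) (wedge-nonneg x y u v)))

  total-∑ᴾ-nonneg : ∀ {A : Set} (h : A → Poly 20) as → (∀ a → 0ℤ ℤ.≤ total (h a)) → 0ℤ ℤ.≤ total (∑ᴾ h as)
  total-∑ᴾ-nonneg h []       h≥0 = ∑ᵛ-nonneg 6 (⟦ con {k = 20} 0ℤ ⟧ ∘ edges) λ _ → ℤ.≤-refl
  total-∑ᴾ-nonneg h (a ∷ as) h≥0 = subst (0ℤ ℤ.≤_) (sym (total-⊕ (h a) (∑ᴾ h as)))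
    (ℤ.+-mono-≤ (h≥0 a) (total-∑ᴾ-nonneg h as h≥0))

  wedges : ℤ
  wedges = ∑ᵛ 4 λ { (x ∷ y ∷ u ∷ v ∷ []) → wedge x y u v }

  -- Stated for arbitrary polynomials and patterns, so that the argument is checked without
  -- expanding the concrete certificate.
  total-≥ : ∀ iss p q d →
    (∀ x → D.⟦ symmetrise D.sumOrbit iss d ⟧ x ≡ false → 0ℤ ℤ.≤ ⟦ symmetrise sumOrbit iss (p ⊝ q) ⟧ x) →
    Avoids d → total q ℤ.≤ total p
  total-≥ iss p q d nonneg avoids = ℤ.0≤i-j⇒j≤i (subst (0ℤ ℤ.≤_) (total-⊝ p q)
    (total-symmetrise-nonneg iss (p ⊝ q)
      (∑ᵛ-nonneg 6 (⟦ symmetrise sumOrbit iss (p ⊝ q) ⟧ ∘ edges) λ t →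
        nonneg (edges t) (avoids-symmetrise iss avoids .misses t))))

  -- The last two positions of the 6-tuple are free, hence the factor n².
  total-wedge : total (var (# 0) ⊗ var (# 1)) ≡ pos (n ^ 2) ℤ.* wedges
  total-wedge = begin
    ∑ᵛ 6 (⟦ var (# 0) ⊗ var (# 1) ⟧ ∘ edges)
      ≡⟨ (ℤ∑.sum-cong-≗ λ x → ℤ∑.sum-cong-≗ λ y → ℤ∑.sum-cong-≗ λ u → ℤ∑.sum-cong-≗ λ v →
           trans (∑ᵛ-cong 2 (wedge-value x y u v)) (∑ᵛ-const 2 (wedge x y u v))) ⟩
    (ℤ∑.sum λ x → ℤ∑.sum λ y → ℤ∑.sum λ u → ℤ∑.sum λ v → pos (n ^ 2) ℤ.* wedge x y u v)
      ≡⟨ ∑ᵛ-* 4 (pos (n ^ 2)) (λ { (x ∷ y ∷ u ∷ v ∷ []) → wedge x y u v }) ⟩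
    pos (n ^ 2) ℤ.* wedges ∎
    where open ≡-Reasoning

  total-squares-nonneg : 0ℤ ℤ.≤ total squares
  total-squares-nonneg = subst (0ℤ ℤ.≤_) (sym (total-⊕ (∑ᴾ pairSquare pairSquares) (∑ᴾ edgePairSquare edgePairSquares)))
    (ℤ.+-mono-≤ (total-∑ᴾ-nonneg pairSquare pairSquares total-pairSquare-nonneg)
                (total-∑ᴾ-nonneg edgePairSquare edgePairSquares total-edgePairSquare-nonneg))

  total-target : total target ≡ pos (n ^ 6) ℤ.* pos 12096 ℤ.- pos 163296 ℤ.* (pos (n ^ 2) ℤ.* wedges)
  total-target = trans (total-⊝ (con (pos 12096)) (163296 · (var (# 0) ⊗ var (# 1))))
      (cong₂ ℤ._-_ (∑ᵛ-const 6 (pos 12096))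
        (trans (total-scale (pos 163296) (var (# 0) ⊗ var (# 1))) (cong (pos 163296 ℤ.*_) total-wedge)))

  -- The large literals stand as right factors, since multiplication of natural numbers recurses on
  -- the left one.
  certificate-bound : Avoids forbidden → (pos (n ^ 2) ℤ.* wedges) ℤ.* pos 163296 ℤ.≤ pos (n ^ 6) ℤ.* pos 12096
  certificate-bound avoids = subst (ℤ._≤ pos (n ^ 6) ℤ.* pos 12096) (ℤ.*-comm (pos 163296) (pos (n ^ 2) ℤ.* wedges))
    (ℤ.0≤i-j⇒j≤i (subst (0ℤ ℤ.≤_) total-target
      (ℤ.≤-trans total-squares-nonneg (total-≥ cosets target squares forbidden certificate-nonneg avoids))))

-- Free graphs avoid the forbidden patterns

∈-tri⁻ : ∀ {n} {z : Fin n} a b c → z ∈ tri a b c → z ≡ a ⊎ z ≡ b ⊎ z ≡ c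
∈-tri⁻ a b c z∈ with x∈p∪q⁻ ⁅ a ⁆ (⁅ b ⁆ ∪ ⁅ c ⁆) z∈
... | inj₁ z∈a = inj₁ (x∈⁅y⁆⇒x≡y a z∈a)
... | inj₂ z∈bc with x∈p∪q⁻ ⁅ b ⁆ ⁅ c ⁆ z∈bc
...   | inj₁ z∈b = inj₂ (inj₁ (x∈⁅y⁆⇒x≡y b z∈b))
...   | inj₂ z∈c = inj₂ (inj₂ (x∈⁅y⁆⇒x≡y c z∈c))

∈-tri⁺ : ∀ {n} {z : Fin n} a b c → z ≡ a ⊎ z ≡ b ⊎ z ≡ c → z ∈ tri a b c
∈-tri⁺ a b c (inj₁ refl)        = x∈p∪q⁺ (inj₁ (x∈⁅x⁆ a))
∈-tri⁺ a b c (inj₂ (inj₁ refl)) = x∈p∪q⁺ {p = ⁅ a ⁆} (inj₂ (x∈p∪q⁺ (inj₁ (x∈⁅x⁆ b))))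
∈-tri⁺ a b c (inj₂ (inj₂ refl)) = x∈p∪q⁺ {p = ⁅ a ⁆} (inj₂ (x∈p∪q⁺ {p = ⁅ b ⁆} (inj₂ (x∈⁅x⁆ c))))

tri-⊆ : ∀ {n} {a b c : Fin n} {S} → a ∈ S → b ∈ S → c ∈ S → tri a b c ⊆ S
tri-⊆ {a = a} {b} {c} a∈ b∈ c∈ z∈ with ∈-tri⁻ a b c z∈
... | inj₁ refl        = a∈
... | inj₂ (inj₁ refl) = b∈
... | inj₂ (inj₂ refl) = c∈

tri-swap₁₂ : ∀ {n} (a b c : Fin n) → tri a b c ≡ tri b a c
tri-swap₁₂ a b c = trans (sym (∪-assoc ⁅ a ⁆ ⁅ b ⁆ ⁅ c ⁆))
  (trans (cong (_∪ ⁅ c ⁆) (∪-comm ⁅ a ⁆ ⁅ b ⁆)) (∪-assoc ⁅ b ⁆ ⁅ a ⁆ ⁅ c ⁆))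

tri-swap₂₃ : ∀ {n} (a b c : Fin n) → tri a b c ≡ tri a c b
tri-swap₂₃ a b c = cong (⁅ a ⁆ ∪_) (∪-comm ⁅ b ⁆ ⁅ c ⁆)

-- Edges are sets, so the same edge may be listed with its vertices in another order; its image
-- depends only on the set.
tri-map-⊆ : ∀ {k n} (g : Fin k → Fin n) {a b c x y z} → tri a b c ≡ tri x y z →
            tri (g a) (g b) (g c) ⊆ tri (g x) (g y) (g z)
tri-map-⊆ g {a} {b} {c} {x} {y} {z} eq = tri-⊆ (image (inj₁ refl)) (image (inj₂ (inj₁ refl))) (image (inj₂ (inj₂ refl)))
  where
  image : ∀ {i} → i ≡ a ⊎ i ≡ b ⊎ i ≡ c → g i ∈ tri (g x) (g y) (g z)
  image {i} i∈ with ∈-tri⁻ x y z (subst (i ∈_) eq (∈-tri⁺ a b c i∈))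
  ... | inj₁ refl        = ∈-tri⁺ (g x) (g y) (g z) (inj₁ refl)
  ... | inj₂ (inj₁ refl) = ∈-tri⁺ (g x) (g y) (g z) (inj₂ (inj₁ refl))
  ... | inj₂ (inj₂ refl) = ∈-tri⁺ (g x) (g y) (g z) (inj₂ (inj₂ refl))

does⁻ : ∀ {A : Set} (a? : Dec A) → does a? ≡ true → A
does⁻ (yes a) _ = a

module _ {n} (G : Graph3 n) where

  isEdge? : ∀ a b c → Dec (IsEdge G a b c)
  isEdge? a b c = ¬? (a Fin.≟ b) ×-dec ¬? (a Fin.≟ c) ×-dec ¬? (b Fin.≟ c) ×-dec (G (tri a b c) 𝔹.≟ true)

  isEdge-swap₁₂ : ∀ {a b c} → IsEdge G a b c → IsEdge G b a c
  isEdge-swap₁₂ {a} {b} {c} (a≢b , a≢c , b≢c , e) = a≢b ∘ sym , b≢c , a≢c , trans (cong G (tri-swap₁₂ b a c)) e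

  isEdge-swap₂₃ : ∀ {a b c} → IsEdge G a b c → IsEdge G a c b
  isEdge-swap₂₃ {a} {b} {c} (a≢b , a≢c , b≢c , e) = a≢c , a≢b , b≢c ∘ sym , trans (cong G (tri-swap₂₃ a c b)) e

  -- Through `IsEdge` a triple with a repeated vertex is a non-edge, which makes the indicator total
  -- and symmetric on all triples.
  edge : Fin n → Fin n → Fin n → Bool
  edge a b c = does (isEdge? a b c)

  edge-swap₁₂ : ∀ a b c → edge a b c ≡ edge b a c
  edge-swap₁₂ a b c = does-⇔ (mk⇔ isEdge-swap₁₂ isEdge-swap₁₂) (isEdge? a b c) (isEdge? b a c)

  edge-swap₂₃ : ∀ a b c → edge a b c ≡ edge a c b
  edge-swap₂₃ a b c = does-⇔ (mk⇔ isEdge-swap₂₃ isEdge-swap₂₃) (isEdge? a b c) (isEdge? a c b)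

  edge⁻ : ∀ {a b c} → edge a b c ≡ true → IsEdge G a b c
  edge⁻ {a} {b} {c} = does⁻ (isEdge? a b c)

  edge⁺ : ∀ {a b c} → IsEdge G a b c → edge a b c ≡ true
  edge⁺ {a} {b} {c} = dec-true (isEdge? a b c)

Triples : ℕ → Set
Triples k = List (Fin k × Fin k × Fin k)

fromTriples⁻ : ∀ {k} (ts : Triples k) S → fromTriples ts S ≡ true → Any (λ (x , y , z) → S ≡ tri x y z) ts
fromTriples⁻ ((x , y , z) ∷ ts) S eq with ≡-dec 𝔹._≟_ S (tri x y z)
... | yes S≡ = here S≡
... | no _   = there (fromTriples⁻ ts S eq)

-- Every member of the forbidden family is covered, so all its homomorphic images in G are embedded copies.
Covered : ∀ {k} → Triples k → Set
Covered ts = ∀ i j → Any (λ (x , y , z) → i ∈ tri x y z × j ∈ tri x y z) ts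

covered? : ∀ {k} (ts : Triples k) → Dec (Covered ts)
covered? ts = Fin.all? λ i → Fin.all? λ j → Any.any? (λ (x , y , z) → (i ∈? tri x y z) ×-dec (j ∈? tri x y z)) ts

module _ {n k} (G : Graph3 n) (ts : Triples k) (covered : Covered ts) (g : Fin k → Fin n)
  (images : All (λ (x , y , z) → IsEdge G (g x) (g y) (g z)) ts) where

  private
    -- The image of a listed edge is an edge of `G`, so its three vertices are distinct.
    injective-on-edge : ∀ {x y z i j} → IsEdge G (g x) (g y) (g z) → i ∈ tri x y z → j ∈ tri x y z → g i ≡ g j → i ≡ j
    injective-on-edge {x} {y} {z} (x≢y , x≢z , y≢z , _) i∈ j∈ eq with ∈-tri⁻ x y z i∈ | ∈-tri⁻ x y z j∈
    ... | inj₁ refl        | inj₁ refl        = refl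
    ... | inj₁ refl        | inj₂ (inj₁ refl) = contradiction eq x≢y
    ... | inj₁ refl        | inj₂ (inj₂ refl) = contradiction eq x≢z
    ... | inj₂ (inj₁ refl) | inj₁ refl        = contradiction (sym eq) x≢y
    ... | inj₂ (inj₁ refl) | inj₂ (inj₁ refl) = refl
    ... | inj₂ (inj₁ refl) | inj₂ (inj₂ refl) = contradiction eq y≢z
    ... | inj₂ (inj₂ refl) | inj₁ refl        = contradiction (sym eq) x≢z
    ... | inj₂ (inj₂ refl) | inj₂ (inj₁ refl) = contradiction (sym eq) y≢z
    ... | inj₂ (inj₂ refl) | inj₂ (inj₂ refl) = refl

    g-injective : Injective _≡_ _≡_ g
    g-injective {i} {j} eq with e , i∈ , j∈ ← All.lookupAny images (covered i j) = injective-on-edge e i∈ j∈ eq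

  homomorphism⇒contains : Contains G (fromTriples ts)
  homomorphism⇒contains = g , g-injective , λ a b c (a≢b , a≢c , b≢c , e) →
    let (_ , _ , _ , e′) , eq = All.lookupAny images (fromTriples⁻ ts (tri a b c) e)
    in a≢b ∘ g-injective , a≢c ∘ g-injective , b≢c ∘ g-injective ,
       trans (cong G (⊆-antisym (tri-map-⊆ g eq) (tri-map-⊆ g (sym eq)))) e′

monomial⁻ : ∀ es x → D.⟦ monomial es ⟧ x ≡ true → All (λ e → lookup x e ≡ true) es
monomial⁻ []       x eq = []
monomial⁻ (e ∷ es) x eq with lookup x e in xe | trans (sym (D.⟦⟧-⊙ e (monomial es) x)) eq
... | true | eq′ = xe ∷ monomial⁻ es x eq′

K4⁻-triples : Triples 4
K4⁻-triples = (w0 , w1 , w2) ∷ (w0 , w1 , w3) ∷ (w0 , w2 , w3) ∷ []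

C5-triples F32-triples : Triples 5
C5-triples  = (v0 , v1 , v2) ∷ (v1 , v2 , v3) ∷ (v2 , v3 , v4) ∷ (v3 , v4 , v0) ∷ (v4 , v0 , v1) ∷ []
F32-triples = (v0 , v1 , v2) ∷ (v0 , v1 , v3) ∷ (v0 , v1 , v4) ∷ (v2 , v3 , v4) ∷ []

-- Counting copies of 4.2

[_] : ∀ {A : Set} → Dec A → ℕ
[ a? ] = if does a? then 1 else 0

-- Splitting on the first vertex replaces the list `allSubsets`, so that counting identities go by
-- induction on n; `∑ˡ-allSubsets` is the bridge.
∑ˢ : ∀ n → (Subset n → ℕ) → ℕ
∑ˢ zero    h = h []
∑ˢ (suc n) h = ∑ˢ n (h ∘ (outside ∷_)) + ∑ˢ n (h ∘ (inside ∷_))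

∑ˢ-cong : ∀ n {h h′} → (∀ S → h S ≡ h′ S) → ∑ˢ n h ≡ ∑ˢ n h′
∑ˢ-cong zero    eq = eq []
∑ˢ-cong (suc n) eq = cong₂ _+_ (∑ˢ-cong n (eq ∘ (outside ∷_))) (∑ˢ-cong n (eq ∘ (inside ∷_)))

∑ˢ-mono : ∀ n {h h′} → (∀ S → h S ≤ h′ S) → ∑ˢ n h ≤ ∑ˢ n h′
∑ˢ-mono zero    le = le []
∑ˢ-mono (suc n) le = ℕ.+-mono-≤ (∑ˢ-mono n (le ∘ (outside ∷_))) (∑ˢ-mono n (le ∘ (inside ∷_)))

∑ˢ-zero : ∀ n → ∑ˢ n (λ _ → 0) ≡ 0
∑ˢ-zero zero    = refl
∑ˢ-zero (suc n) = cong₂ _+_ (∑ˢ-zero n) (∑ˢ-zero n)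

∑ˢ-+ : ∀ n h h′ → ∑ˢ n (λ S → h S + h′ S) ≡ ∑ˢ n h + ∑ˢ n h′
∑ˢ-+ zero    h h′ = refl
∑ˢ-+ (suc n) h h′ = trans
  (cong₂ _+_ (∑ˢ-+ n (h ∘ (outside ∷_)) (h′ ∘ (outside ∷_))) (∑ˢ-+ n (h ∘ (inside ∷_)) (h′ ∘ (inside ∷_))))
  (CommutativeSemigroupProperties.interchange ℕ.+-commutativeSemigroup (∑ˢ n (h ∘ (outside ∷_))) _ _ _)

∑ˢ-* : ∀ n c h → ∑ˢ n (λ S → c * h S) ≡ c * ∑ˢ n h
∑ˢ-* zero    c h = refl
∑ˢ-* (suc n) c h = trans (cong₂ _+_ (∑ˢ-* n c (h ∘ (outside ∷_))) (∑ˢ-* n c (h ∘ (inside ∷_))))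
  (sym (ℕ.*-distribˡ-+ c (∑ˢ n (h ∘ (outside ∷_))) (∑ˢ n (h ∘ (inside ∷_)))))

∑ˢ-sum : ∀ n {m} (h : Fin m → Subset n → ℕ) → ∑ˢ n (λ S → ℕ∑.sum λ i → h i S) ≡ ℕ∑.sum (λ i → ∑ˢ n (h i))
∑ˢ-sum n {zero}  h = ∑ˢ-zero n
∑ˢ-sum n {suc m} h = trans (∑ˢ-+ n (h zero) (λ S → ℕ∑.sum λ i → h (suc i) S))
  (cong (∑ˢ n (h zero) +_) (∑ˢ-sum n (h ∘ suc)))

∑ˢ-≟ : ∀ n A → ∑ˢ n (λ S → [ ≡-dec 𝔹._≟_ S A ]) ≡ 1
∑ˢ-≟ zero    []          = refl
∑ˢ-≟ (suc n) (true ∷ A)  = cong₂ _+_ (∑ˢ-zero n) (∑ˢ-≟ n A)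
∑ˢ-≟ (suc n) (false ∷ A) = trans (cong₂ _+_ (∑ˢ-≟ n A) (∑ˢ-zero n)) (ℕ.+-identityʳ 1)

∑ˡ : ∀ {A : Set} → (A → ℕ) → List A → ℕ
∑ˡ h []       = 0
∑ˡ h (a ∷ as) = h a + ∑ˡ h as

∑ˡ-allSubsets : ∀ n h → ∑ˡ h (allSubsets n) ≡ ∑ˢ n h
∑ˡ-allSubsets zero    h = ℕ.+-identityʳ _
∑ˡ-allSubsets (suc n) h = trans (∑ˡ-++ (List.map (outside ∷_) (allSubsets n)) _)
  (cong₂ _+_ (trans (∑ˡ-map (allSubsets n)) (∑ˡ-allSubsets n (h ∘ (outside ∷_))))
             (trans (∑ˡ-map (allSubsets n)) (∑ˡ-allSubsets n (h ∘ (inside ∷_)))))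
  where
  ∑ˡ-++ : ∀ as bs → ∑ˡ h (as List.++ bs) ≡ ∑ˡ h as + ∑ˡ h bs
  ∑ˡ-++ []       bs = refl
  ∑ˡ-++ (a ∷ as) bs = trans (cong (h a +_) (∑ˡ-++ as bs)) (sym (ℕ.+-assoc (h a) _ _))
  ∑ˡ-map : ∀ {g : Subset n → Subset (suc n)} as → ∑ˡ h (List.map g as) ≡ ∑ˡ (h ∘ g) as
  ∑ˡ-map []       = refl
  ∑ˡ-map {g} (a ∷ as) = cong (h (g a) +_) (∑ˡ-map as)

module _ {A : Set} {P : A → Set} (P? : ∀ a → Dec (P a)) where

  ∑ˡ-filter : ∀ h as → ∑ˡ h (filter P? as) ≡ ∑ˡ (λ a → [ P? a ] * h a) as
  ∑ˡ-filter h []       = refl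
  ∑ˡ-filter h (a ∷ as) with does (P? a)
  ... | true  = cong₂ _+_ (sym (ℕ.+-identityʳ (h a))) (∑ˡ-filter h as)
  ... | false = ∑ˡ-filter h as

  length-filter-∑ˡ : ∀ as → length (filter P? as) ≡ ∑ˡ (λ a → [ P? a ]) as
  length-filter-∑ˡ []       = refl
  length-filter-∑ˡ (a ∷ as) with does (P? a)
  ... | true  = cong suc (length-filter-∑ˡ as)
  ... | false = length-filter-∑ˡ as

e42-∑ˢ : ∀ {n} (G : Graph3 n) → e42 G ≡ ∑ˢ n λ S → [ ∣ S ∣ ℕ.≟ 4 ] * [ edgesIn G S ℕ.≟ 2 ]
e42-∑ˢ {n} G = begin
  e42 G
    ≡⟨ length-filter-∑ˡ (λ S → edgesIn G S ℕ.≟ 2) (filter (λ S → ∣ S ∣ ℕ.≟ 4) (allSubsets n)) ⟩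
  ∑ˡ (λ S → [ edgesIn G S ℕ.≟ 2 ]) (filter (λ S → ∣ S ∣ ℕ.≟ 4) (allSubsets n))
    ≡⟨ ∑ˡ-filter (λ S → ∣ S ∣ ℕ.≟ 4) (λ S → [ edgesIn G S ℕ.≟ 2 ]) (allSubsets n) ⟩
  ∑ˡ (λ S → [ ∣ S ∣ ℕ.≟ 4 ] * [ edgesIn G S ℕ.≟ 2 ]) (allSubsets n)
    ≡⟨ ∑ˡ-allSubsets n _ ⟩
  ∑ˢ n (λ S → [ ∣ S ∣ ℕ.≟ 4 ] * [ edgesIn G S ℕ.≟ 2 ]) ∎
  where open ≡-Reasoning

edgesIn-∑ˢ : ∀ {n} (G : Graph3 n) S →
  edgesIn G S ≡ ∑ˢ n λ T → [ G T 𝔹.≟ true ] * ([ T ⊆? S ] * [ ∣ T ∣ ℕ.≟ 3 ])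
edgesIn-∑ˢ {n} G S = begin
  edgesIn G S
    ≡⟨ length-filter-∑ˡ (λ T → ∣ T ∣ ℕ.≟ 3) (filter (_⊆? S) (filter (λ T → G T 𝔹.≟ true) (allSubsets n))) ⟩
  ∑ˡ (λ T → [ ∣ T ∣ ℕ.≟ 3 ]) (filter (_⊆? S) (filter (λ T → G T 𝔹.≟ true) (allSubsets n)))
    ≡⟨ ∑ˡ-filter (_⊆? S) (λ T → [ ∣ T ∣ ℕ.≟ 3 ]) (filter (λ T → G T 𝔹.≟ true) (allSubsets n)) ⟩
  ∑ˡ (λ T → [ T ⊆? S ] * [ ∣ T ∣ ℕ.≟ 3 ]) (filter (λ T → G T 𝔹.≟ true) (allSubsets n))
    ≡⟨ ∑ˡ-filter (λ T → G T 𝔹.≟ true) (λ T → [ T ⊆? S ] * [ ∣ T ∣ ℕ.≟ 3 ]) (allSubsets n) ⟩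
  ∑ˡ (λ T → [ G T 𝔹.≟ true ] * ([ T ⊆? S ] * [ ∣ T ∣ ℕ.≟ 3 ])) (allSubsets n)
    ≡⟨ ∑ˡ-allSubsets n _ ⟩
  ∑ˢ n (λ T → [ G T 𝔹.≟ true ] * ([ T ⊆? S ] * [ ∣ T ∣ ℕ.≟ 3 ])) ∎
  where open ≡-Reasoning

-- Extracting a wedge from a 4-set with two edges

allSubsets-unique : ∀ n → Unique (allSubsets n)
allSubsets-unique zero    = [] ∷ []
allSubsets-unique (suc n) = ++⁺ (map⁺ ∷-injectiveʳ (allSubsets-unique n)) (map⁺ ∷-injectiveʳ (allSubsets-unique n))
  λ { (S∈ , S∈′) → outside≢inside (∈-map⁻ (outside ∷_) S∈) (∈-map⁻ (inside ∷_) S∈′) }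
  where
  outside≢inside : ∀ {S} → ∃[ T ] (T ∈ˡ allSubsets n × S ≡ outside ∷ T) →
                   ∃[ T ] (T ∈ˡ allSubsets n × S ≡ inside ∷ T) → Empty.⊥
  outside≢inside (_ , _ , refl) (_ , _ , ())

∉p-x : ∀ {n} {x : Fin n} p → x ∉ p - x
∉p-x {x = zero}  (_ ∷ p) ()
∉p-x {x = suc x} (_ ∷ p) (thereᵛ x∈) = ∉p-x p x∈

∣p-x∣ : ∀ {n} {x : Fin n} {p} → x ∈ p → ∣ p ∣ ≡ suc ∣ p - x ∣
∣p-x∣ {p = inside ∷ p}  hereᵛ       = cong (suc ∘ ∣_∣) (sym (p─⊥≡p p))
∣p-x∣ {p = inside ∷ p}  (thereᵛ x∈) = cong suc (∣p-x∣ x∈)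
∣p-x∣ {p = outside ∷ p} (thereᵛ x∈) = ∣p-x∣ x∈

nonempty : ∀ {n m} (p : Subset n) → ∣ p ∣ ≡ suc m → ∃[ x ] x ∈ p
nonempty {n} p size with nonempty? p
... | yes x∈p = x∈p
... | no  p∅ with () ← trans (sym size) (trans (cong ∣_∣ (Empty-unique p∅)) (∣⊥∣≡0 n))

⊆∧∣∣≡⇒≡ : ∀ {n} {p q : Subset n} → p ⊆ q → ∣ p ∣ ≡ ∣ q ∣ → p ≡ q
⊆∧∣∣≡⇒≡ {p = p} {q} p⊆q size = ⊆-antisym p⊆q q⊆p
  where
  q⊆p : q ⊆ p
  q⊆p {x} x∈q with x ∈? p
  ... | yes x∈p = x∈p
  ... | no  x∉p = contradiction size (ℕ.<⇒≢ (p⊂q⇒∣p∣<∣q∣ (p⊆q , x , x∈q , x∉p)))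

-- If no element of `q` were missing from `p`, then q ⊆ p would contradict the sizes. For a missing
-- x, `p` lies in `q - x`, and the sizes agree.
missing-one : ∀ {n m} {p q : Subset n} → p ⊆ q → ∣ p ∣ ≡ m → ∣ q ∣ ≡ suc m → ∃[ x ] (x ∈ q × p ≡ q - x)
missing-one {p = p} {q} p⊆q ∣p∣ ∣q∣ with Fin.any? (λ x → (x ∈? q) ×-dec ¬? (x ∈? p))
... | yes (x , x∈q , x∉p) = x , x∈q ,
      ⊆∧∣∣≡⇒≡ (λ y∈p → x∈p∧x≢y⇒x∈p-y (p⊆q y∈p) λ { refl → x∉p y∈p })
        (trans ∣p∣ (ℕ.suc-injective (trans (sym ∣q∣) (∣p-x∣ x∈q))))
... | no none = contradiction (p⊆q⇒∣p∣≤∣q∣ q⊆p) (ℕ.<⇒≱ (ℕ.≤-reflexive (trans (cong suc ∣p∣) (sym ∣q∣))))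
  where
  q⊆p : q ⊆ p
  q⊆p {x} x∈q with x ∈? p
  ... | yes x∈p = x∈p
  ... | no  x∉p = contradiction (x , x∈q , x∉p) none

two-elements : ∀ {A : Set} {as : List A} → Unique as → length as ≡ 2 → ∃[ a ] ∃[ b ] (a ∈ˡ as × b ∈ˡ as × a ≢ b)
two-elements {as = a ∷ b ∷ []} ((a≢b ∷ []) ∷ _) _ = a , b , here refl , there (here refl) , a≢b

∈⇒≡⊎∈- : ∀ {n} {z : Fin n} x {p} → z ∈ p → z ≡ x ⊎ z ∈ p - x
∈⇒≡⊎∈- {z = z} x z∈p with z Fin.≟ x
... | yes z≡x = inj₁ z≡x
... | no  z≢x = inj₂ (x∈p∧x≢y⇒x∈p-y z∈p z≢x)

-⇒≢ : ∀ {n} {z x : Fin n} p → z ∈ p - x → z ≢ x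
-⇒≢ p z∈ refl = ∉p-x p z∈

-- Bracketed in pairs, so that exchanging x with y, or u with v, is one use of commutativity.
quad : ∀ {n} → Fin n → Fin n → Fin n → Fin n → Subset n
quad x y u v = (⁅ x ⁆ ∪ ⁅ y ⁆) ∪ (⁅ u ⁆ ∪ ⁅ v ⁆)

record Wedge {n} (G : Graph3 n) (S : Subset n) : Set where
  field
    x y u v : Fin n
    x≢y : x ≢ y
    u≢v : u ≢ v
    xyu : IsEdge G x y u
    xyv : IsEdge G x y v
    support : S ≡ quad x y u v

-- Each of the two edges omits exactly one vertex of S, and the omitted vertices differ because the
-- edges do. The other two vertices of S form the shared pair.
wedge-in : ∀ {n} (G : Graph3 n) S → ∣ S ∣ ≡ 4 → edgesIn G S ≡ 2 → Wedge G S
wedge-in {n} G S ∣S∣ e≡2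
  with T , T′ , T∈ , T′∈ , T≢T′ ← two-elements
    (filter⁺ (λ T → ∣ T ∣ ℕ.≟ 3) (filter⁺ (_⊆? S) (filter⁺ (λ T → G T 𝔹.≟ true) (allSubsets-unique n)))) e≡2
  with T∈₁ , ∣T∣ ← ∈-filter⁻ (λ T → ∣ T ∣ ℕ.≟ 3) T∈
  with T∈₂ , T⊆S ← ∈-filter⁻ (_⊆? S) T∈₁
  with _ , GT ← ∈-filter⁻ (λ T → G T 𝔹.≟ true) {xs = allSubsets n} T∈₂
  with T′∈₁ , ∣T′∣ ← ∈-filter⁻ (λ T → ∣ T ∣ ℕ.≟ 3) T′∈
  with T′∈₂ , T′⊆S ← ∈-filter⁻ (_⊆? S) T′∈₁
  with _ , GT′ ← ∈-filter⁻ (λ T → G T 𝔹.≟ true) {xs = allSubsets n} T′∈₂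
  -- The names are crossed on purpose: the edge omitting `v` becomes xyu, the one omitting `u`
  -- becomes xyv.
  with v , v∈S , refl ← missing-one T⊆S ∣T∣ ∣S∣
  with u , u∈S , refl ← missing-one T′⊆S ∣T′∣ ∣S∣ = wedge
  where
  u≢v : u ≢ v
  u≢v refl = T≢T′ refl
  R = (S - v) - u
  ∣R∣ : ∣ R ∣ ≡ 2
  ∣R∣ = ℕ.suc-injective (trans (sym (∣p-x∣ (x∈p∧x≢y⇒x∈p-y u∈S u≢v))) ∣T∣)
  x = proj₁ (nonempty R ∣R∣)
  x∈R = proj₂ (nonempty R ∣R∣)
  ∣R-x∣ : ∣ R - x ∣ ≡ 1
  ∣R-x∣ = ℕ.suc-injective (trans (sym (∣p-x∣ x∈R)) ∣R∣)
  y = proj₁ (nonempty (R - x) ∣R-x∣)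
  y∈R-x = proj₂ (nonempty (R - x) ∣R-x∣)
  y∈R = p─q⊆p R ⁅ x ⁆ y∈R-x
  x∈S-v = p─q⊆p (S - v) ⁅ u ⁆ x∈R
  y∈S-v = p─q⊆p (S - v) ⁅ u ⁆ y∈R
  x∈S = p─q⊆p S ⁅ v ⁆ x∈S-v
  y∈S = p─q⊆p S ⁅ v ⁆ y∈S-v
  x≢y = -⇒≢ R y∈R-x ∘ sym
  x≢u = -⇒≢ (S - v) x∈R
  y≢u = -⇒≢ (S - v) y∈R
  x≢v = -⇒≢ S x∈S-v
  y≢v = -⇒≢ S y∈S-v

  elements : ∀ {z} → z ∈ S → z ≡ v ⊎ z ≡ u ⊎ z ≡ x ⊎ z ≡ y
  elements z∈S with ∈⇒≡⊎∈- v z∈S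
  ... | inj₁ z≡v = inj₁ z≡v
  ... | inj₂ z∈S-v with ∈⇒≡⊎∈- u z∈S-v
  ...   | inj₁ z≡u = inj₂ (inj₁ z≡u)
  ...   | inj₂ z∈R with ∈⇒≡⊎∈- x z∈R
  ...     | inj₁ z≡x = inj₂ (inj₂ (inj₁ z≡x))
  ...     | inj₂ z∈R-x with ∈⇒≡⊎∈- y z∈R-x
  ...       | inj₁ z≡y = inj₂ (inj₂ (inj₂ z≡y))
  ...       | inj₂ z∈∅ with () ← trans (sym (∣p-x∣ z∈∅)) (ℕ.suc-injective (trans (sym (∣p-x∣ y∈R-x)) ∣R-x∣))

  tri-xyu : tri x y u ≡ S - v
  tri-xyu = ⊆-antisym (tri-⊆ x∈S-v y∈S-v (x∈p∧x≢y⇒x∈p-y u∈S u≢v)) λ z∈S-v →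
    ∈-tri⁺ x y u ([ (λ z≡v → contradiction z≡v (-⇒≢ S z∈S-v)) ,
      [ (λ z≡u → inj₂ (inj₂ z≡u)) , [ inj₁ , (λ z≡y → inj₂ (inj₁ z≡y)) ]′ ]′ ]′ (elements (p─q⊆p S ⁅ v ⁆ z∈S-v)))

  tri-xyv : tri x y v ≡ S - u
  tri-xyv = ⊆-antisym
    (tri-⊆ (x∈p∧x≢y⇒x∈p-y x∈S x≢u) (x∈p∧x≢y⇒x∈p-y y∈S y≢u) (x∈p∧x≢y⇒x∈p-y v∈S (u≢v ∘ sym))) λ z∈S-u →
    ∈-tri⁺ x y v ([ (λ z≡v → inj₂ (inj₂ z≡v)) ,
      [ (λ z≡u → contradiction z≡u (-⇒≢ S z∈S-u)) , [ inj₁ , (λ z≡y → inj₂ (inj₁ z≡y)) ]′ ]′ ]′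
        (elements (p─q⊆p S ⁅ u ⁆ z∈S-u)))

  support : S ≡ quad x y u v
  support = ⊆-antisym
    (λ z∈S → [ (λ { refl → x∈p∪q⁺ {p = ⁅ x ⁆ ∪ ⁅ y ⁆} (inj₂ (x∈p∪q⁺ {p = ⁅ u ⁆} (inj₂ (x∈⁅x⁆ v)))) }) ,
      [ (λ { refl → x∈p∪q⁺ {p = ⁅ x ⁆ ∪ ⁅ y ⁆} (inj₂ (x∈p∪q⁺ (inj₁ (x∈⁅x⁆ u)))) }) ,
        [ (λ { refl → x∈p∪q⁺ (inj₁ (x∈p∪q⁺ (inj₁ (x∈⁅x⁆ x)))) }) ,
          (λ { refl → x∈p∪q⁺ (inj₁ (x∈p∪q⁺ {p = ⁅ x ⁆} (inj₂ (x∈⁅x⁆ y)))) }) ]′ ]′ ]′ (elements z∈S))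
    λ z∈ → [ (λ z∈xy → [ (λ z∈x → subst (_∈ S) (sym (x∈⁅y⁆⇒x≡y x z∈x)) x∈S) ,
                         (λ z∈y → subst (_∈ S) (sym (x∈⁅y⁆⇒x≡y y z∈y)) y∈S) ]′ (x∈p∪q⁻ ⁅ x ⁆ ⁅ y ⁆ z∈xy)) ,
             (λ z∈uv → [ (λ z∈u → subst (_∈ S) (sym (x∈⁅y⁆⇒x≡y u z∈u)) u∈S) ,
                         (λ z∈v → subst (_∈ S) (sym (x∈⁅y⁆⇒x≡y v z∈v)) v∈S) ]′ (x∈p∪q⁻ ⁅ u ⁆ ⁅ v ⁆ z∈uv)) ]′
           (x∈p∪q⁻ (⁅ x ⁆ ∪ ⁅ y ⁆) (⁅ u ⁆ ∪ ⁅ v ⁆) z∈)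

  wedge : Wedge G S
  wedge = record
    { x = x ; y = y ; u = u ; v = v ; x≢y = x≢y ; u≢v = u≢v
    ; xyu = x≢y , x≢u , y≢u , trans (cong G tri-xyu) GT
    ; xyv = x≢y , x≢v , y≢v , trans (cong G tri-xyv) GT′
    ; support = support }

-- Double counting of wedges and copies of 4.2

sum-≥₁ : ∀ {n} (g : Fin n → ℕ) i → g i ≤ ℕ∑.sum g
sum-≥₁ g zero    = ℕ.m≤m+n (g zero) _
sum-≥₁ g (suc i) = ℕ.≤-trans (sum-≥₁ (g ∘ suc) i) (ℕ.m≤n+m _ (g zero))

sum-≥₂ : ∀ {n} (g : Fin n → ℕ) {i j} → i ≢ j → g i + g j ≤ ℕ∑.sum g
sum-≥₂ g {zero}  {zero}  i≢j = contradiction refl i≢j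
sum-≥₂ g {zero}  {suc j} i≢j = ℕ.+-monoʳ-≤ (g zero) (sum-≥₁ (g ∘ suc) j)
sum-≥₂ g {suc i} {zero}  i≢j = subst (_≤ ℕ∑.sum g) (ℕ.+-comm (g zero) (g (suc i)))
  (ℕ.+-monoʳ-≤ (g zero) (sum-≥₁ (g ∘ suc) i))
sum-≥₂ g {suc i} {suc j} i≢j = ℕ.≤-trans (sum-≥₂ (g ∘ suc) (i≢j ∘ cong suc)) (ℕ.m≤n+m _ (g zero))

pos-sum : ∀ {n} (g : Fin n → ℕ) → pos (ℕ∑.sum g) ≡ ℤ∑.sum (pos ∘ g)
pos-sum {zero}  g = refl
pos-sum {suc n} g = cong (ℤ._+_ (pos (g zero))) (pos-sum (g ∘ suc))

module _ {n} (G : Graph3 n) where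

  open Certificate (edge G) (edge-swap₁₂ G) (edge-swap₂₃ G)

  isWedge : Fin n → Fin n → Fin n → Fin n → ℕ
  isWedge x y u v = if edge G x y u ∧ edge G x y v then 1 else 0

  isWedge≡1 : ∀ {x y u v} → IsEdge G x y u → IsEdge G x y v → isWedge x y u v ≡ 1
  isWedge≡1 {x} {y} {u} {v} xyu xyv =
    cong₂ (λ b c → if b ∧ c then 1 else 0) (edge⁺ G {x} {y} {u} xyu) (edge⁺ G {x} {y} {v} xyv)

  wedgesℕ : ℕ
  wedgesℕ = ℕ∑.sum λ x → ℕ∑.sum λ y → ℕ∑.sum λ u → ℕ∑.sum λ v → isWedge x y u v

  pos-wedgesℕ : pos wedgesℕ ≡ wedges
  pos-wedgesℕ = trans (pos-sum λ x → ℕ∑.sum λ y → ℕ∑.sum λ u → ℕ∑.sum λ v → isWedge x y u v) (ℤ∑.sum-cong-≗ λ x →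
    trans (pos-sum λ y → ℕ∑.sum λ u → ℕ∑.sum λ v → isWedge x y u v) (ℤ∑.sum-cong-≗ λ y →
    trans (pos-sum λ u → ℕ∑.sum λ v → isWedge x y u v) (ℤ∑.sum-cong-≗ λ u →
    trans (pos-sum λ v → isWedge x y u v) (ℤ∑.sum-cong-≗ λ v → pos-if (edge G x y u) (edge G x y v)))))
    where
    pos-if : ∀ b c → pos (if b ∧ c then 1 else 0) ≡ indicator b ℤ.* indicator c
    pos-if true  true  = refl
    pos-if true  false = refl
    pos-if false true  = refl
    pos-if false false = refl

  supported : Subset n → Fin n → Fin n → Fin n → Fin n → ℕ
  supported S x y u v = isWedge x y u v * [ ≡-dec 𝔹._≟_ S (quad x y u v) ]

  supportedWedges : Subset n → ℕ
  supportedWedges S = ℕ∑.sum λ x → ℕ∑.sum λ y → ℕ∑.sum λ u → ℕ∑.sum λ v → supported S x y u v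

  -- After exchanging the sums, each quadruple is counted at exactly one set, namely its own `quad`.
  ∑ˢ-supportedWedges : ∑ˢ n supportedWedges ≡ wedgesℕ
  ∑ˢ-supportedWedges =
    trans (∑ˢ-sum n λ x S → ℕ∑.sum λ y → ℕ∑.sum λ u → ℕ∑.sum λ v → supported S x y u v) (ℕ∑.sum-cong-≗ λ x →
    trans (∑ˢ-sum n λ y S → ℕ∑.sum λ u → ℕ∑.sum λ v → supported S x y u v) (ℕ∑.sum-cong-≗ λ y →
    trans (∑ˢ-sum n λ u S → ℕ∑.sum λ v → supported S x y u v) (ℕ∑.sum-cong-≗ λ u →
    trans (∑ˢ-sum n λ v S → supported S x y u v) (ℕ∑.sum-cong-≗ λ v →
    trans (∑ˢ-* n (isWedge x y u v) λ S → [ ≡-dec 𝔹._≟_ S (quad x y u v) ])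
      (trans (cong (isWedge x y u v *_) (∑ˢ-≟ n (quad x y u v))) (ℕ.*-identityʳ _))))))

  supported≡1 : ∀ {S x y u v} → S ≡ quad x y u v → IsEdge G x y u → IsEdge G x y v → supported S x y u v ≡ 1
  supported≡1 {S} {x} {y} {u} {v} S≡ xyu xyv = cong₂ _*_ (isWedge≡1 xyu xyv)
    (cong (λ b → if b then 1 else 0) (dec-true (≡-dec 𝔹._≟_ S (quad x y u v)) S≡))

  -- Exchanging x with y and u with v gives four ordered quadruples with the same support; they are
  -- different since x ≢ y and u ≢ v.
  supportedWedges≥4 : ∀ {S} → Wedge G S → 4 ≤ supportedWedges S
  supportedWedges≥4 {S} w = ℕ.≤-trans (ℕ.+-mono-≤ (pair support xyu xyv)
      (pair (trans support (cong (_∪ (⁅ u ⁆ ∪ ⁅ v ⁆)) (∪-comm ⁅ x ⁆ ⁅ y ⁆)))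
        (isEdge-swap₁₂ G xyu) (isEdge-swap₁₂ G xyv)))
    (ℕ.≤-trans (ℕ.+-mono-≤ (sum-≥₁ (row x) y) (sum-≥₁ (row y) x)) (sum-≥₂ (ℕ∑.sum ∘ row) x≢y))
    where
    open Wedge w
    row : Fin n → Fin n → ℕ
    row a b = ℕ∑.sum λ c → ℕ∑.sum λ d → supported S a b c d
    pair : ∀ {a b} → S ≡ quad a b u v → IsEdge G a b u → IsEdge G a b v → 2 ≤ row a b
    pair {a} {b} S≡ abu abv = ℕ.≤-trans (ℕ.+-mono-≤
        (subst (_≤ ℕ∑.sum (supported S a b u)) (supported≡1 S≡ abu abv) (sum-≥₁ (supported S a b u) v))
        (subst (_≤ ℕ∑.sum (supported S a b v))
          (supported≡1 (trans S≡ (cong ((⁅ a ⁆ ∪ ⁅ b ⁆) ∪_) (∪-comm ⁅ u ⁆ ⁅ v ⁆))) abv abu)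
          (sum-≥₁ (supported S a b v) u)))
      (sum-≥₂ (λ c → ℕ∑.sum (supported S a b c)) u≢v)

  4*e42≤wedges : 4 * e42 G ≤ wedgesℕ
  4*e42≤wedges = begin
    4 * e42 G
      ≡⟨ cong (4 *_) (e42-∑ˢ G) ⟩
    4 * ∑ˢ n (λ S → [ ∣ S ∣ ℕ.≟ 4 ] * [ edgesIn G S ℕ.≟ 2 ])
      ≡⟨ ∑ˢ-* n 4 (λ S → [ ∣ S ∣ ℕ.≟ 4 ] * [ edgesIn G S ℕ.≟ 2 ]) ⟨
    ∑ˢ n (λ S → 4 * ([ ∣ S ∣ ℕ.≟ 4 ] * [ edgesIn G S ℕ.≟ 2 ]))
      ≤⟨ ∑ˢ-mono n local ⟩
    ∑ˢ n supportedWedges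
      ≡⟨ ∑ˢ-supportedWedges ⟩
    wedgesℕ ∎
    where
    open ℕ.≤-Reasoning
    local : ∀ S → 4 * ([ ∣ S ∣ ℕ.≟ 4 ] * [ edgesIn G S ℕ.≟ 2 ]) ≤ supportedWedges S
    local S = indicators (∣ S ∣ ℕ.≟ 4) (edgesIn G S ℕ.≟ 2) λ size e → supportedWedges≥4 (wedge-in G S size e)
      where
      indicators : ∀ {A B : Set} {m} (a? : Dec A) (b? : Dec B) → (A → B → 4 ≤ m) → 4 * ([ a? ] * [ b? ]) ≤ m
      indicators (yes a) (yes b) h = h a b
      indicators (yes _) (no _)  h = z≤n
      indicators (no _)  _       h = z≤n

  avoids-monomial : ∀ es → (∀ t → ¬ All (λ e → lookup (edges t) e ≡ true) es) → Avoids (monomial es)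
  avoids-monomial es h = avoiding λ t → 𝔹.¬-not (h t ∘ monomial⁻ es (edges t))

  avoids-forbidden : Free G → Avoids forbidden
  avoids-forbidden (¬K4⁻ , ¬C5 , ¬F32) =
    avoids-⊕ (avoids-monomial K4⁻-edges λ { (a ∷ b ∷ c ∷ d ∷ _ ∷ _ ∷ []) (abc ∷ abd ∷ acd ∷ []) →
      ¬K4⁻ (homomorphism⇒contains G K4⁻-triples (from-yes (covered? K4⁻-triples)) (lookup (a ∷ b ∷ c ∷ d ∷ []))
        (edge⁻ G abc ∷ edge⁻ G abd ∷ edge⁻ G acd ∷ [])) })
    (avoids-⊕ (avoids-monomial C5-edges λ { (a ∷ b ∷ c ∷ d ∷ e ∷ _ ∷ []) (abc ∷ bcd ∷ cde ∷ ade ∷ abe ∷ []) →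
      ¬C5 (homomorphism⇒contains G C5-triples (from-yes (covered? C5-triples)) (lookup (a ∷ b ∷ c ∷ d ∷ e ∷ []))
        (edge⁻ G abc ∷ edge⁻ G bcd ∷ edge⁻ G cde
          -- The edges ade and abe are rotated to dea and eab, the order used in `C5-triples`.
          ∷ isEdge-swap₂₃ G (isEdge-swap₁₂ G (edge⁻ G ade)) ∷ isEdge-swap₁₂ G (isEdge-swap₂₃ G (edge⁻ G abe)) ∷ [])) })
    (avoids-monomial F32-edges λ { (a ∷ b ∷ c ∷ d ∷ e ∷ _ ∷ []) (abc ∷ abd ∷ abe ∷ cde ∷ []) →
      ¬F32 (homomorphism⇒contains G F32-triples (from-yes (covered? F32-triples)) (lookup (a ∷ b ∷ c ∷ d ∷ e ∷ []))
        (edge⁻ G abc ∷ edge⁻ G abd ∷ edge⁻ G abe ∷ edge⁻ G cde ∷ [])) }))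

  -- With n⁶ = n²·n⁴, 163296 = 6048·27 and 12096 = 6048·2, the common factor n²·6048 cancels.
  27*wedges≤2*n⁴ : Free G → .{{_ : ℕ.NonZero n}} → 27 * wedgesℕ ≤ 2 * n ^ 4
  27*wedges≤2*n⁴ free = cancel (n ^ 2) 6048 27 2 {{ℕ.m^n≢0 n 2}} (subst (λ m → n ^ 2 * wedgesℕ * 163296 ≤ m * 12096)
    (ℕ.^-distribˡ-+-* n 2 4)
    (drop-pos (n ^ 2) wedgesℕ 163296 (n ^ 6) 12096
      (subst (λ w → (pos (n ^ 2) ℤ.* w) ℤ.* pos 163296 ℤ.≤ pos (n ^ 6) ℤ.* pos 12096) (sym pos-wedgesℕ)
        (certificate-bound (avoids-forbidden free)))))
    where
    open +-*-Solver
    drop-pos : ∀ a b c d e → (pos a ℤ.* pos b) ℤ.* pos c ℤ.≤ pos d ℤ.* pos e → a * b * c ≤ d * e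
    drop-pos a b c d e le = ℤ.drop‿+≤+ (subst₂ ℤ._≤_
      (trans (cong (ℤ._* pos c) (sym (ℤ.pos-* a b))) (sym (ℤ.pos-* (a * b) c))) (sym (ℤ.pos-* d e)) le)
    -- Variables in place of the constants keep the large literals away from the ring solver.
    cancel : ∀ a c d e {b w} .{{_ : ℕ.NonZero a}} .{{_ : ℕ.NonZero c}} →
             a * w * (c * d) ≤ a * b * (c * e) → d * w ≤ e * b
    cancel a c d e {b} {w} le = ℕ.*-cancelˡ-≤ (a * c) {{ℕ.m*n≢0 a c}} (subst₂ _≤_
      (solve 4 (λ a c d w → a :* w :* (c :* d) := a :* c :* (d :* w)) refl a c d w)
      (solve 4 (λ a c e b → a :* b :* (c :* e) := a :* c :* (e :* b)) refl a c e b) le)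

  54*e42≤n⁴ : Free G → .{{_ : ℕ.NonZero n}} → 54 * e42 G ≤ n ^ 4
  54*e42≤n⁴ free = ℕ.*-cancelˡ-≤ 2 (begin
    2 * (54 * e42 G)  ≡⟨ trans (sym (ℕ.*-assoc 2 54 (e42 G))) (ℕ.*-assoc 27 4 (e42 G)) ⟩
    27 * (4 * e42 G)  ≤⟨ ℕ.*-monoʳ-≤ 27 4*e42≤wedges ⟩
    27 * wedgesℕ        ≤⟨ 27*wedges≤2*n⁴ free ⟩
    2 * n ^ 4         ∎)
    where open ℕ.≤-Reasoning

-- The complete tripartite graph

-- The vector `κ` colours each vertex by its part; the value is the size of S within part j.
hits : ∀ {n} → Fin 3 → Vec (Fin 3) n → Subset n → ℕ
hits j []      []          = 0
hits j (c ∷ κ) (false ∷ S) = hits j κ S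
hits j (c ∷ κ) (true ∷ S)  = [ j Fin.≟ c ] + hits j κ S

∣∣-hits : ∀ {n} (κ : Vec (Fin 3) n) S → ∣ S ∣ ≡ hits (# 0) κ S + hits (# 1) κ S + hits (# 2) κ S
∣∣-hits []      []          = refl
∣∣-hits (c ∷ κ) (false ∷ S) = ∣∣-hits κ S
∣∣-hits (c ∷ κ) (true ∷ S)  = trans (cong suc (∣∣-hits κ S)) (add c)
  where
  a = hits (# 0) κ S ; b = hits (# 1) κ S ; d = hits (# 2) κ S
  add : ∀ c → suc (a + b + d) ≡ ([ # 0 Fin.≟ c ] + a) + ([ # 1 Fin.≟ c ] + b) + ([ # 2 Fin.≟ c ] + d)
  add zero             = refl
  add (suc zero)       = cong (_+ d) (sym (ℕ.+-suc a b))
  add (suc (suc zero)) = sym (ℕ.+-suc (a + b) d)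

profile : ∀ {n} → Vec (Fin 3) n → ℕ → ℕ → ℕ → Subset n → ℕ
profile κ i j k T = [ hits (# 0) κ T ℕ.≟ i ] * ([ hits (# 1) κ T ℕ.≟ j ] * [ hits (# 2) κ T ℕ.≟ k ])

∑ˢ-zeros : ∀ n {h} → (∀ S → h S ≡ 0) → ∑ˢ n h ≡ 0
∑ˢ-zeros n h≡0 = trans (∑ˢ-cong n h≡0) (∑ˢ-zero n)

-- The vertices of T are chosen independently in the three parts. In the induction a first vertex in
-- S changes only the binomial of its own colour, by Pascal's rule; if that colour is to occur zero
-- times, the sets containing the vertex contribute nothing.
∑ˢ-profile : ∀ {n} (κ : Vec (Fin 3) n) S i j k →
  ∑ˢ n (λ T → [ T ⊆? S ] * profile κ i j k T)
    ≡ (hits (# 0) κ S C i) * ((hits (# 1) κ S C j) * (hits (# 2) κ S C k))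
∑ˢ-profile [] [] zero    zero    zero    = refl
∑ˢ-profile [] [] zero    zero    (suc k) = refl
∑ˢ-profile [] [] zero    (suc j) k       = refl
∑ˢ-profile [] [] (suc i) j       k       = refl
∑ˢ-profile {suc n} (c ∷ κ) (false ∷ S) i j k =
  trans (cong₂ _+_ (∑ˢ-profile κ S i j k) (∑ˢ-zero n)) (ℕ.+-identityʳ _)
∑ˢ-profile {suc n} (zero ∷ κ) (true ∷ S) zero j k =
  trans (cong₂ _+_ (∑ˢ-profile κ S zero j k) (∑ˢ-zeros n λ T → ℕ.*-zeroʳ [ T ⊆? S ])) (ℕ.+-identityʳ _)
∑ˢ-profile {suc n} (zero ∷ κ) (true ∷ S) (suc i) j k = begin
  _ ≡⟨ cong₂ _+_ (∑ˢ-profile κ S (suc i) j k) (∑ˢ-profile κ S i j k) ⟩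
  (a C suc i) * r + (a C i) * r ≡⟨ ℕ.*-distribʳ-+ r (a C suc i) (a C i) ⟨
  (a C suc i + a C i) * r         ≡⟨ cong (_* r) (trans (ℕ.+-comm (a C suc i) (a C i)) (nCk+nC[k+1]≡[n+1]C[k+1] a i)) ⟩
  (suc a C suc i) * r             ∎
  where
  open ≡-Reasoning
  a = hits (# 0) κ S
  r = (hits (# 1) κ S C j) * (hits (# 2) κ S C k)
∑ˢ-profile {suc n} (suc zero ∷ κ) (true ∷ S) i zero k =
  trans (cong₂ _+_ (∑ˢ-profile κ S i zero k) (∑ˢ-zeros n λ T →
    trans (cong ([ T ⊆? S ] *_) (ℕ.*-zeroʳ [ hits (# 0) κ T ℕ.≟ i ])) (ℕ.*-zeroʳ [ T ⊆? S ]))) (ℕ.+-identityʳ _)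
∑ˢ-profile {suc n} (suc zero ∷ κ) (true ∷ S) i (suc j) k = begin
  _ ≡⟨ cong₂ _+_ (∑ˢ-profile κ S i (suc j) k) (∑ˢ-profile κ S i j k) ⟩
  p * ((b C suc j) * q) + p * ((b C j) * q) ≡⟨ ℕ.*-distribˡ-+ p _ _ ⟨
  p * ((b C suc j) * q + (b C j) * q)         ≡⟨ cong (p *_) (ℕ.*-distribʳ-+ q (b C suc j) (b C j)) ⟨
  p * ((b C suc j + b C j) * q)
    ≡⟨ cong (λ m → p * (m * q)) (trans (ℕ.+-comm (b C suc j) (b C j)) (nCk+nC[k+1]≡[n+1]C[k+1] b j)) ⟩
  p * ((suc b C suc j) * q)                     ∎
  where
  open ≡-Reasoning
  b = hits (# 1) κ S
  p = hits (# 0) κ S C i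
  q = hits (# 2) κ S C k
∑ˢ-profile {suc n} (suc (suc zero) ∷ κ) (true ∷ S) i j zero =
  trans (cong₂ _+_ (∑ˢ-profile κ S i j zero) (∑ˢ-zeros n λ T →
    trans (cong ([ T ⊆? S ] *_) (trans (cong ([ hits (# 0) κ T ℕ.≟ i ] *_) (ℕ.*-zeroʳ [ hits (# 1) κ T ℕ.≟ j ]))
      (ℕ.*-zeroʳ [ hits (# 0) κ T ℕ.≟ i ]))) (ℕ.*-zeroʳ [ T ⊆? S ]))) (ℕ.+-identityʳ _)
∑ˢ-profile {suc n} (suc (suc zero) ∷ κ) (true ∷ S) i j (suc k) = begin
  _ ≡⟨ cong₂ _+_ (∑ˢ-profile κ S i j (suc k)) (∑ˢ-profile κ S i j k) ⟩
  p * (q * (d C suc k)) + p * (q * (d C k)) ≡⟨ ℕ.*-distribˡ-+ p _ _ ⟨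
  p * (q * (d C suc k) + q * (d C k))         ≡⟨ cong (p *_) (ℕ.*-distribˡ-+ q (d C suc k) (d C k)) ⟨
  p * (q * (d C suc k + d C k))
    ≡⟨ cong (λ m → p * (q * m)) (trans (ℕ.+-comm (d C suc k) (d C k)) (nCk+nC[k+1]≡[n+1]C[k+1] d k)) ⟩
  p * (q * (suc d C suc k))                     ∎
  where
  open ≡-Reasoning
  d = hits (# 2) κ S
  p = hits (# 0) κ S C i
  q = hits (# 1) κ S C j

tripartite : ∀ {n} → Vec (Fin 3) n → Graph3 n
tripartite κ T = does ((hits (# 0) κ T ℕ.≟ 1) ×-dec (hits (# 1) κ T ℕ.≟ 1) ×-dec (hits (# 2) κ T ℕ.≟ 1))

hits-≥₁ : ∀ {n} (κ : Vec (Fin 3) n) {S p} → p ∈ S → 1 ≤ hits (lookup κ p) κ S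
hits-≥₁ (c ∷ κ) hereᵛ rewrite dec-true (c Fin.≟ c) refl = s≤s z≤n
hits-≥₁ (c ∷ κ) {true ∷ S}  (thereᵛ {i = p} p∈) = ℕ.≤-trans (hits-≥₁ κ p∈) (ℕ.m≤n+m _ [ lookup κ p Fin.≟ c ])
hits-≥₁ (c ∷ κ) {false ∷ S} (thereᵛ p∈) = hits-≥₁ κ p∈

hits-≥₂ : ∀ {n} (κ : Vec (Fin 3) n) {S p q} → p ∈ S → q ∈ S → p ≢ q → lookup κ p ≡ lookup κ q →
          2 ≤ hits (lookup κ p) κ S
hits-≥₂ κ hereᵛ hereᵛ p≢q _ = contradiction refl p≢q
hits-≥₂ (c ∷ κ) {_ ∷ S} hereᵛ (thereᵛ q∈) _ eq rewrite dec-true (c Fin.≟ c) refl =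
  s≤s (subst (λ j → 1 ≤ hits j κ S) (sym eq) (hits-≥₁ κ q∈))
hits-≥₂ (c ∷ κ) {_ ∷ S} (thereᵛ {i = p} p∈) hereᵛ _ eq rewrite dec-true (lookup κ p Fin.≟ c) eq = s≤s (hits-≥₁ κ p∈)
hits-≥₂ (c ∷ κ) {true ∷ S} (thereᵛ {i = p} p∈) (thereᵛ q∈) p≢q eq =
  ℕ.≤-trans (hits-≥₂ κ p∈ q∈ (p≢q ∘ cong suc) eq) (ℕ.m≤n+m _ [ lookup κ p Fin.≟ c ])
hits-≥₂ (c ∷ κ) {false ∷ S} (thereᵛ p∈) (thereᵛ q∈) p≢q eq = hits-≥₂ κ p∈ q∈ (p≢q ∘ cong suc) eq

tripartite-hits : ∀ {n} (κ : Vec (Fin 3) n) T → tripartite κ T ≡ true → ∀ c → hits c κ T ≡ 1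
tripartite-hits κ T eq c
  with h₀ , h₁ , h₂ ← does⁻ ((hits (# 0) κ T ℕ.≟ 1) ×-dec (hits (# 1) κ T ℕ.≟ 1) ×-dec (hits (# 2) κ T ℕ.≟ 1)) eq
  with c
... | zero           = h₀
... | suc zero       = h₁
... | suc (suc zero) = h₂

-- A closed statement about `Fin 3`, so that it can be decided by enumeration.
ThirdColour : Set
ThirdColour = ∀ (a b c d : Fin 3) → a ≢ b → a ≢ c → b ≢ c → a ≢ d → b ≢ d → c ≡ d

thirdColour? : Dec ThirdColour
thirdColour? = (Fin.all? λ a → Fin.all? λ b → Fin.all? λ c → Fin.all? λ d →
  ¬? (a Fin.≟ b) →-dec (¬? (a Fin.≟ c) →-dec (¬? (b Fin.≟ c)
    →-dec (¬? (a Fin.≟ d) →-dec (¬? (b Fin.≟ d) →-dec (c Fin.≟ d))))))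

third-colour : ThirdColour
third-colour = from-yes thirdColour?

module _ {n} (κ : Vec (Fin 3) n) where

  Rainbow : Fin 3 → Fin 3 → Fin 3 → Set
  Rainbow a b c = a ≢ b × a ≢ c × b ≢ c

  rainbow : ∀ {p q r} → IsEdge (tripartite κ) p q r → Rainbow (lookup κ p) (lookup κ q) (lookup κ r)
  rainbow {p} {q} {r} (p≢q , p≢r , q≢r , e) = distinct p∈ q∈ p≢q , distinct p∈ r∈ p≢r , distinct q∈ r∈ q≢r
    where
    p∈ = ∈-tri⁺ p q r (inj₁ refl)
    q∈ = ∈-tri⁺ p q r (inj₂ (inj₁ refl))
    r∈ = ∈-tri⁺ p q r (inj₂ (inj₂ refl))
    distinct : ∀ {s t} → s ∈ tri p q r → t ∈ tri p q r → s ≢ t → lookup κ s ≢ lookup κ t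
    distinct {s} s∈ t∈ s≢t eq = ℕ.<-irrefl refl
      (subst (2 ≤_) (tripartite-hits κ (tri p q r) e (lookup κ s)) (hits-≥₂ κ s∈ t∈ s≢t eq))

  same-colour : ∀ {a b c d} → Rainbow a b c → Rainbow a b d → c ≡ d
  same-colour (a≢b , a≢c , b≢c) (_ , a≢d , b≢d) = third-colour _ _ _ _ a≢b a≢c b≢c a≢d b≢d

  -- Edges sharing a pair have their third vertices in the same part. Each forbidden graph has two
  -- such edges whose third vertices also lie together in another edge, where colours must differ.
  tripartite-free : Free (tripartite κ)
  tripartite-free =
    (λ { (f , _ , e) →
      let (_ , _ , c₂≢c₃) = rainbow (e w0 w2 w3 ((λ ()) , (λ ()) , (λ ()) , refl)) in
      c₂≢c₃ (same-colour (rainbow (e w0 w1 w2 ((λ ()) , (λ ()) , (λ ()) , refl)))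
                         (rainbow (e w0 w1 w3 ((λ ()) , (λ ()) , (λ ()) , refl)))) }) ,
    (λ { (f , _ , e) →
      let (_ , c₃≢c₀ , _) = rainbow (e v3 v4 v0 ((λ ()) , (λ ()) , (λ ()) , refl)) in
      c₃≢c₀ (same-colour (rainbow (e v1 v2 v3 ((λ ()) , (λ ()) , (λ ()) , refl)))
                         (rainbow (e v1 v2 v0 ((λ ()) , (λ ()) , (λ ()) , refl)))) }) ,
    (λ { (f , _ , e) →
      let (c₂≢c₃ , _ , _) = rainbow (e v2 v3 v4 ((λ ()) , (λ ()) , (λ ()) , refl)) in
      c₂≢c₃ (same-colour (rainbow (e v0 v1 v2 ((λ ()) , (λ ()) , (λ ()) , refl)))
                         (rainbow (e v0 v1 v3 ((λ ()) , (λ ()) , (λ ()) , refl)))) })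

  edgesIn-tripartite : ∀ S → edgesIn (tripartite κ) S ≡ hits (# 0) κ S * (hits (# 1) κ S * hits (# 2) κ S)
  edgesIn-tripartite S = begin
    edgesIn (tripartite κ) S
      ≡⟨ edgesIn-∑ˢ (tripartite κ) S ⟩
    ∑ˢ n (λ T → [ tripartite κ T 𝔹.≟ true ] * ([ T ⊆? S ] * [ ∣ T ∣ ℕ.≟ 3 ]))
      ≡⟨ ∑ˢ-cong n local ⟩
    ∑ˢ n (λ T → [ T ⊆? S ] * profile κ 1 1 1 T)
      ≡⟨ ∑ˢ-profile κ S 1 1 1 ⟩
    (hits (# 0) κ S C 1) * ((hits (# 1) κ S C 1) * (hits (# 2) κ S C 1))
      ≡⟨ cong₂ _*_ (nC1≡n (hits (# 0) κ S)) (cong₂ _*_ (nC1≡n (hits (# 1) κ S)) (nC1≡n (hits (# 2) κ S))) ⟩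
    hits (# 0) κ S * (hits (# 1) κ S * hits (# 2) κ S) ∎
    where
    open ≡-Reasoning
    indicators : ∀ {A B C : Set} (a? : Dec A) (b? : Dec B) (c? : Dec C) d s → (A → B → C → s ≡ 3) →
      [ (does a? ∧ (does b? ∧ does c?)) 𝔹.≟ true ] * (d * [ s ℕ.≟ 3 ]) ≡ d * ([ a? ] * ([ b? ] * [ c? ]))
    indicators (yes a) (yes b) (yes c) d s s≡3 rewrite s≡3 a b c = ℕ.+-identityʳ (d * 1)
    indicators (yes _) (yes _) (no _)  d s _ = sym (ℕ.*-zeroʳ d)
    indicators (yes _) (no _)  _       d s _ = sym (ℕ.*-zeroʳ d)
    indicators (no _)  _       _       d s _ = sym (ℕ.*-zeroʳ d)
    -- A set meeting each part in one vertex has size 3, so both sides count the same sets.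
    local : ∀ T → [ tripartite κ T 𝔹.≟ true ] * ([ T ⊆? S ] * [ ∣ T ∣ ℕ.≟ 3 ]) ≡ [ T ⊆? S ] * profile κ 1 1 1 T
    local T = indicators (hits (# 0) κ T ℕ.≟ 1) (hits (# 1) κ T ℕ.≟ 1) (hits (# 2) κ T ℕ.≟ 1) [ T ⊆? S ] ∣ T ∣
      λ a b c → trans (∣∣-hits κ T) (cong₂ _+_ (cong₂ _+_ a b) c)

  private
    a = hits (# 0) κ ⊤
    b = hits (# 1) κ ⊤
    c = hits (# 2) κ ⊤

  -- A 4-set meeting the parts in 2, 1 and 1 vertices, in any order, spans 2·1·1 edges.
  e42-tripartite : (a C 2) * (b * c) + (a * ((b C 2) * c) + a * (b * (c C 2))) ≤ e42 (tripartite κ)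
  e42-tripartite = begin
    (a C 2) * (b * c) + (a * ((b C 2) * c) + a * (b * (c C 2)))
      ≡⟨ cong₂ _+_ (cong ((a C 2) *_) (cong₂ _*_ (nC1≡n b) (nC1≡n c)))
          (cong₂ _+_ (cong₂ _*_ (nC1≡n a) (cong ((b C 2) *_) (nC1≡n c)))
            (cong₂ _*_ (nC1≡n a) (cong (_* (c C 2)) (nC1≡n b)))) ⟨
    (a C 2) * ((b C 1) * (c C 1)) + ((a C 1) * ((b C 2) * (c C 1)) + (a C 1) * ((b C 1) * (c C 2)))
      ≡⟨ cong₂ _+_ (count 2 1 1) (cong₂ _+_ (count 1 2 1) (count 1 1 2)) ⟨
    ∑ˢ n (profile κ 2 1 1) + (∑ˢ n (profile κ 1 2 1) + ∑ˢ n (profile κ 1 1 2))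
      ≡⟨ trans (∑ˢ-+ n (profile κ 2 1 1) (λ S → profile κ 1 2 1 S + profile κ 1 1 2 S))
          (cong (_+_ (∑ˢ n (profile κ 2 1 1))) (∑ˢ-+ n (profile κ 1 2 1) (profile κ 1 1 2))) ⟨
    ∑ˢ n (λ S → profile κ 2 1 1 S + (profile κ 1 2 1 S + profile κ 1 1 2 S))
      ≤⟨ ∑ˢ-mono n local ⟩
    ∑ˢ n (λ S → [ ∣ S ∣ ℕ.≟ 4 ] * [ edgesIn (tripartite κ) S ℕ.≟ 2 ])
      ≡⟨ e42-∑ˢ (tripartite κ) ⟨
    e42 (tripartite κ) ∎
    where
    open ℕ.≤-Reasoning
    count : ∀ i j k → ∑ˢ n (profile κ i j k) ≡ (a C i) * ((b C j) * (c C k))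
    count i j k = trans (∑ˢ-cong n λ T → trans (sym (ℕ.*-identityˡ _))
        (cong (_* profile κ i j k T) (cong (λ d → if d then 1 else 0) (sym (dec-true (T ⊆? ⊤) ⊆⊤)))))
      (∑ˢ-profile κ ⊤ i j k)
    cases : ∀ x y z →
      [ x ℕ.≟ 2 ] * ([ y ℕ.≟ 1 ] * [ z ℕ.≟ 1 ])
        + ([ x ℕ.≟ 1 ] * ([ y ℕ.≟ 2 ] * [ z ℕ.≟ 1 ]) + [ x ℕ.≟ 1 ] * ([ y ℕ.≟ 1 ] * [ z ℕ.≟ 2 ]))
        ≤ [ x + y + z ℕ.≟ 4 ] * [ x * (y * z) ℕ.≟ 2 ]
    cases 0 y z = z≤n
    cases 1 0 z = z≤n
    cases 1 1 0 = z≤n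
    cases 1 1 1 = z≤n
    cases 1 1 2 = ℕ.≤-refl
    cases 1 1 (suc (suc (suc z))) = z≤n
    cases 1 2 0 = z≤n
    cases 1 2 1 = ℕ.≤-refl
    cases 1 2 (suc (suc z)) = z≤n
    cases 1 (suc (suc (suc y))) z = z≤n
    cases 2 0 z = z≤n
    cases 2 1 0 = z≤n
    cases 2 1 1 = ℕ.≤-refl
    cases 2 1 (suc (suc z)) = z≤n
    cases 2 (suc (suc y)) z = z≤n
    cases (suc (suc (suc x))) y z = z≤n
    local : ∀ S → profile κ 2 1 1 S + (profile κ 1 2 1 S + profile κ 1 1 2 S)
                  ≤ [ ∣ S ∣ ℕ.≟ 4 ] * [ edgesIn (tripartite κ) S ℕ.≟ 2 ]
    local S = subst₂
      (λ s e → profile κ 2 1 1 S + (profile κ 1 2 1 S + profile κ 1 1 2 S) ≤ [ s ℕ.≟ 4 ] * [ e ℕ.≟ 2 ])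
      (sym (∣∣-hits κ S)) (sym (edgesIn-tripartite S))
      (cases (hits (# 0) κ S) (hits (# 1) κ S) (hits (# 2) κ S))

balanced : ∀ n → Vec (Fin 3) n
balanced 0 = []
balanced 1 = # 0 ∷ []
balanced 2 = # 0 ∷ # 1 ∷ []
balanced (suc (suc (suc n))) = # 0 ∷ # 1 ∷ # 2 ∷ balanced n

-- Each block of three adds one vertex to every part, and at most two vertices are left over.
balanced-hits : ∀ n c → n ≤ 2 + 3 * hits c (balanced n) ⊤
balanced-hits 0 c = z≤n
balanced-hits 1 c = s≤s z≤n
balanced-hits 2 c = s≤s (s≤s z≤n)
balanced-hits (suc (suc (suc n))) c = subst (3 + n ≤_) (step c)
  (ℕ.+-monoʳ-≤ 3 (balanced-hits n c))
  where
  step : ∀ c → 3 + (2 + 3 * hits c (balanced n) ⊤) ≡ 2 + 3 * hits c (balanced (3 + n)) ⊤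
  step zero             = cong (2 +_) (sym (ℕ.*-suc 3 _))
  step (suc zero)       = cong (2 +_) (sym (ℕ.*-suc 3 _))
  step (suc (suc zero)) = cong (2 +_) (sym (ℕ.*-suc 3 _))

-- Binomial estimates

C-absorption : ∀ n k → suc k * (suc n C suc k) ≡ suc n * (n C k)
C-absorption n zero = begin
  1 * (suc n C 1)  ≡⟨ ℕ.*-identityˡ _ ⟩
  suc n C 1        ≡⟨ nC1≡n (suc n) ⟩
  suc n            ≡⟨ ℕ.*-identityʳ (suc n) ⟨
  suc n * (n C 0)  ∎
  where open ≡-Reasoning
C-absorption zero (suc k) = begin
  suc (suc k) * (1 C suc (suc k)) ≡⟨ cong (suc (suc k) *_) (k>n⇒nCk≡0 {1} {suc (suc k)} (s≤s (s≤s z≤n))) ⟩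
  suc (suc k) * 0                 ≡⟨ ℕ.*-zeroʳ (suc (suc k)) ⟩
  0                               ≡⟨ cong (1 *_) (k>n⇒nCk≡0 {0} {suc k} (s≤s z≤n)) ⟨
  1 * (0 C suc k)                 ∎
  where open ≡-Reasoning
C-absorption (suc n) (suc k) = begin
  suc (suc k) * (suc (suc n) C suc (suc k))
    ≡⟨ cong (suc (suc k) *_) (nCk+nC[k+1]≡[n+1]C[k+1] (suc n) (suc k)) ⟨
  suc (suc k) * (p + q)
    ≡⟨ solve 3 (λ k p q → (con 1 :+ (con 1 :+ k)) :* (p :+ q)
         := p :+ ((con 1 :+ k) :* p :+ (con 1 :+ (con 1 :+ k)) :* q)) refl k p q ⟩
  p + (suc k * p + suc (suc k) * q)
    ≡⟨ cong (p +_) (cong₂ _+_ (C-absorption n k) (C-absorption n (suc k))) ⟩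
  p + (suc n * (n C k) + suc n * (n C suc k))
    ≡⟨ cong (p +_) (ℕ.*-distribˡ-+ (suc n) (n C k) (n C suc k)) ⟨
  p + suc n * (n C k + n C suc k)
    ≡⟨ cong (λ m → p + suc n * m) (nCk+nC[k+1]≡[n+1]C[k+1] n k) ⟩
  suc (suc n) * (suc n C suc k) ∎
  where
  open ≡-Reasoning
  open +-*-Solver
  p = suc n C suc k
  q = suc n C suc (suc k)

-- With n = m + 3 this is n(n - 1)(n - 2)(n - 3); the shift avoids truncated subtraction.
falling₄ : ℕ → ℕ
falling₄ m = (3 + m) * ((2 + m) * ((1 + m) * m))

24*C4 : ∀ m → 24 * ((3 + m) C 4) ≡ falling₄ m
24*C4 m = begin
  24 * ((3 + m) C 4)                        ≡⟨ ℕ.*-assoc 6 4 ((3 + m) C 4) ⟩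
  6 * (4 * ((3 + m) C 4))                   ≡⟨ cong (6 *_) (C-absorption (2 + m) 3) ⟩
  6 * ((3 + m) * ((2 + m) C 3))
    ≡⟨ solve 2 (λ a b → con 6 :* (a :* b) := a :* (con 2 :* (con 3 :* b))) refl (3 + m) ((2 + m) C 3) ⟩
  (3 + m) * (2 * (3 * ((2 + m) C 3)))       ≡⟨ cong (λ c → (3 + m) * (2 * c)) (C-absorption (1 + m) 2) ⟩
  (3 + m) * (2 * ((2 + m) * ((1 + m) C 2)))
    ≡⟨ solve 3 (λ a b c → a :* (con 2 :* (b :* c)) := a :* (b :* (con 2 :* c))) refl (3 + m) (2 + m) ((1 + m) C 2) ⟩
  (3 + m) * ((2 + m) * (2 * ((1 + m) C 2)))
    ≡⟨ cong (λ c → (3 + m) * ((2 + m) * c)) (trans (C-absorption m 1) (cong ((1 + m) *_) (nC1≡n m))) ⟩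
  (3 + m) * ((2 + m) * ((1 + m) * m))       ∎
  where
  open ≡-Reasoning
  open +-*-Solver

2*C2+n : ∀ n → 2 * (n C 2) + n ≡ n * n
2*C2+n zero    = refl
2*C2+n (suc n) = trans (cong (_+ suc n) (trans (C-absorption n 1) (cong (suc n *_) (nC1≡n n))))
  (trans (ℕ.+-comm (suc n * n) (suc n)) (sym (ℕ.*-suc (suc n) n)))

-- For n = m + 3 the difference between n⁴ and the falling factorial is cubic in n. Multiplied by 4K
-- it is of order 24K·m³, at most 4m⁴ by 6K ≤ m, which the 9 times the falling factorial on the
-- right absorbs.
upper-arith : ∀ K m C e → 6 * K ≤ m → 24 * C ≡ falling₄ m → 54 * e ≤ (3 + m) ^ 4 → 9 * K * e ≤ (4 * K + 9) * C
upper-arith K m C e 6K≤m 24C 54e = ℕ.*-cancelˡ-≤ 24 (begin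
  24 * (9 * K * e)
    ≡⟨ solve 2 (λ K e → con 24 :* (con 9 :* K :* e) := con 4 :* K :* (con 54 :* e)) refl K e ⟩
  4 * K * (54 * e)                  ≤⟨ ℕ.*-monoʳ-≤ (4 * K) 54e ⟩
  4 * K * (3 + m) ^ 4
    -- The padding makes every coefficient of the excess divisible by 6, so that 6K can be replaced
    -- by m.
    ≤⟨ ℕ.m≤m+n _ (2 * K * (m * m)) ⟩
  4 * K * (3 + m) ^ 4 + 2 * K * (m * m)
    ≡⟨ solve 2 (λ K m → con 4 :* K :* (con 3 :+ m) :^ 4 :+ con 2 :* K :* (m :* m)
         := con 4 :* K :* ((con 3 :+ m) :* ((con 2 :+ m) :* ((con 1 :+ m) :* m)))
            :+ con 6 :* K :* (con 4 :* m :^ 3 :+ con 29 :* m :^ 2 :+ con 68 :* m :+ con 54)) refl K m ⟩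
  4 * K * falling₄ m + 6 * K * (4 * m ^ 3 + 29 * m ^ 2 + 68 * m + 54)
    ≤⟨ ℕ.+-monoʳ-≤ (4 * K * falling₄ m) (ℕ.*-monoˡ-≤ _ 6K≤m) ⟩
  4 * K * falling₄ m + m * (4 * m ^ 3 + 29 * m ^ 2 + 68 * m + 54)
    -- The added polynomial is what remains of 9·`falling₄ m`.
    ≤⟨ ℕ.m≤m+n _ (5 * m ^ 4 + 25 * m ^ 3 + 31 * m ^ 2) ⟩
  4 * K * falling₄ m + m * (4 * m ^ 3 + 29 * m ^ 2 + 68 * m + 54) + (5 * m ^ 4 + 25 * m ^ 3 + 31 * m ^ 2)
    ≡⟨ solve 2 (λ K m → let X = (con 3 :+ m) :* ((con 2 :+ m) :* ((con 1 :+ m) :* m)) in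
         con 4 :* K :* X :+ m :* (con 4 :* m :^ 3 :+ con 29 :* m :^ 2 :+ con 68 :* m :+ con 54)
           :+ (con 5 :* m :^ 4 :+ con 25 :* m :^ 3 :+ con 31 :* m :^ 2)
         := (con 4 :* K :+ con 9) :* X) refl K m ⟩
  (4 * K + 9) * falling₄ m          ≡⟨ cong ((4 * K + 9) *_) 24C ⟨
  (4 * K + 9) * (24 * C)            ≡⟨ solve 2 (λ a C → a :* (con 24 :* C) := con 24 :* (a :* C)) refl (4 * K + 9) C ⟩
  24 * ((4 * K + 9) * C)            ∎)
  where
  open ℕ.≤-Reasoning
  open +-*-Solver

lower-arith : ∀ K m C e → 6 * K ≤ m → 24 * C ≡ falling₄ m → (1 + m) ^ 3 * m ≤ 54 * e → 4 * K * C ≤ 9 * K * e + 9 * C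
lower-arith K m C e 6K≤m 24C 54e = ℕ.*-cancelˡ-≤ 24 (begin
  24 * (4 * K * C)
    ≡⟨ solve 2 (λ K C → con 24 :* (con 4 :* K :* C) := con 4 :* K :* (con 24 :* C)) refl K C ⟩
  4 * K * (24 * C)                        ≡⟨ cong (4 * K *_) 24C ⟩
  4 * K * falling₄ m
    -- (m + 3)(m + 2) exceeds (m + 1)² by 3m + 5; the padding raises this to 3m + 6, and 4K(3m + 6)
    -- = 6K(2m + 4).
    ≤⟨ ℕ.m≤m+n _ (4 * K * ((1 + m) * m)) ⟩
  4 * K * falling₄ m + 4 * K * ((1 + m) * m)
    ≡⟨ solve 2 (λ K m → con 4 :* K :* ((con 3 :+ m) :* ((con 2 :+ m) :* ((con 1 :+ m) :* m)))
           :+ con 4 :* K :* ((con 1 :+ m) :* m)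
         := con 4 :* K :* ((con 1 :+ m) :^ 3 :* m)
           :+ con 6 :* K :* (con 2 :* m :+ con 4) :* ((con 1 :+ m) :* m)) refl K m ⟩
  4 * K * ((1 + m) ^ 3 * m) + 6 * K * (2 * m + 4) * ((1 + m) * m)
    ≤⟨ ℕ.+-mono-≤ (ℕ.*-monoʳ-≤ (4 * K) 54e) (ℕ.*-monoˡ-≤ ((1 + m) * m) (ℕ.*-monoˡ-≤ (2 * m + 4) 6K≤m)) ⟩
  4 * K * (54 * e) + m * (2 * m + 4) * ((1 + m) * m)
    ≤⟨ ℕ.m≤m+n _ ((7 * m ^ 2 + 41 * m + 54) * ((1 + m) * m)) ⟩
  4 * K * (54 * e) + m * (2 * m + 4) * ((1 + m) * m) + (7 * m ^ 2 + 41 * m + 54) * ((1 + m) * m)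
    ≡⟨ solve 3 (λ K e m → con 4 :* K :* (con 54 :* e) :+ m :* (con 2 :* m :+ con 4) :* ((con 1 :+ m) :* m)
           :+ (con 7 :* m :^ 2 :+ con 41 :* m :+ con 54) :* ((con 1 :+ m) :* m)
         := con 24 :* (con 9 :* K :* e) :+ con 9 :* ((con 3 :+ m) :* ((con 2 :+ m) :* ((con 1 :+ m) :* m)))) refl K e m ⟩
  24 * (9 * K * e) + 9 * falling₄ m       ≡⟨ cong (λ x → 24 * (9 * K * e) + 9 * x) 24C ⟨
  24 * (9 * K * e) + 9 * (24 * C)
    ≡⟨ solve 2 (λ x C → con 24 :* x :+ con 9 :* (con 24 :* C) := con 24 :* (x :+ con 9 :* C)) refl (9 * K * e) C ⟩
  24 * (9 * K * e + 9 * C)                ∎)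
  where
  open ℕ.≤-Reasoning
  open +-*-Solver

-- Twice the count of 4-sets is abc(a + b + c - 3) = abc·m, and each of 3a, 3b, 3c is at least m +
-- 1.
tripartite-arith : ∀ m a b c e → a + b + c ≡ 3 + m → 3 + m ≤ 2 + 3 * a → 3 + m ≤ 2 + 3 * b → 3 + m ≤ 2 + 3 * c →
  (a C 2) * (b * c) + (a * ((b C 2) * c) + a * (b * (c C 2))) ≤ e → (1 + m) ^ 3 * m ≤ 54 * e
tripartite-arith m a b c e size a≥ b≥ c≥ e≥ = begin
  (1 + m) ^ 3 * m
    ≤⟨ ℕ.*-monoˡ-≤ m (ℕ.*-mono-≤ (third {a} a≥) (ℕ.*-mono-≤ (third {b} b≥) (ℕ.*-monoˡ-≤ 1 (third {c} c≥)))) ⟩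
  3 * a * (3 * b * (3 * c * 1)) * m
    ≡⟨ solve 4 (λ a b c m → con 3 :* a :* (con 3 :* b :* (con 3 :* c :* con 1)) :* m
         := con 27 :* (a :* b :* c :* m)) refl a b c m ⟩
  27 * (a * b * c * m)
    ≡⟨ cong (27 *_) pairs ⟨
  27 * (2 * E)
    ≡⟨ ℕ.*-assoc 27 2 E ⟨
  54 * E
    ≤⟨ ℕ.*-monoʳ-≤ 54 e≥ ⟩
  54 * e ∎
  where
  open ℕ.≤-Reasoning
  open +-*-Solver
  E = (a C 2) * (b * c) + (a * ((b C 2) * c) + a * (b * (c C 2)))
  third : ∀ {x} → 3 + m ≤ 2 + 3 * x → 1 + m ≤ 3 * x
  third (s≤s (s≤s le)) = le
  pairs : 2 * E ≡ a * b * c * m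
  -- Adding 3abc to both sides avoids subtraction: each 2·(x C 2) is completed to a square by x.
  pairs = ℕ.+-cancelʳ-≡ (3 * (a * b * c)) (2 * E) (a * b * c * m) (begin-equality
    2 * E + 3 * (a * b * c)
      ≡⟨ solve 6 (λ a b c x y z → con 2 :* (x :* (b :* c) :+ (a :* (y :* c) :+ a :* (b :* z))) :+ con 3 :* (a :* b :* c)
           := (con 2 :* x :+ a) :* (b :* c) :+ ((con 2 :* y :+ b) :* (a :* c) :+ (con 2 :* z :+ c) :* (a :* b)))
           refl a b c (a C 2) (b C 2) (c C 2) ⟩
    (2 * (a C 2) + a) * (b * c) + ((2 * (b C 2) + b) * (a * c) + (2 * (c C 2) + c) * (a * b))
      ≡⟨ cong₂ _+_ (cong (_* (b * c)) (2*C2+n a))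
           (cong₂ _+_ (cong (_* (a * c)) (2*C2+n b)) (cong (_* (a * b)) (2*C2+n c))) ⟩
    a * a * (b * c) + (b * b * (a * c) + c * c * (a * b))
      ≡⟨ solve 3 (λ a b c → a :* a :* (b :* c) :+ (b :* b :* (a :* c) :+ c :* c :* (a :* b))
           := a :* b :* c :* (a :+ b :+ c)) refl a b c ⟩
    a * b * c * (a + b + c)
      ≡⟨ cong (a * b * c *_) size ⟩
    a * b * c * (3 + m)
      ≡⟨ solve 2 (λ p m → p :* (con 3 :+ m) := p :* m :+ con 3 :* p) refl (a * b * c) m ⟩
    a * b * c * m + 3 * (a * b * c) ∎)

-- The limit is expressed with tolerance 1/K for K = `suc k`. After division by 9K·(n C 4), the
-- first bound reads 4/9 + 1/K and the second 4/9 - 1/K.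
theorem2p19 : ∀ (k : ℕ) → ∃[ N ] ∀ (n : ℕ) → N ≤ n →
    ((∀ (G : Graph3 n) → Free G → 9 * suc k * e42 G ≤ (4 * suc k + 9) * (n C 4))
    × (∃[ G ] (Free {n} G × 4 * suc k * (n C 4) ≤ 9 * suc k * e42 G + 9 * (n C 4))))
theorem2p19 k = 3 + 6 * suc k , bounds
  where
  bounds : ∀ n → 3 + 6 * suc k ≤ n →
    ((∀ (G : Graph3 n) → Free G → 9 * suc k * e42 G ≤ (4 * suc k + 9) * (n C 4))
    × (∃[ G ] (Free {n} G × 4 * suc k * (n C 4) ≤ 9 * suc k * e42 G + 9 * (n C 4))))
  -- Writing n = m + 3 turns the threshold 3 + 6K ≤ n into 6K ≤ m, the form used by both estimates.
  bounds (suc (suc (suc m))) (s≤s (s≤s (s≤s 6K≤m))) =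
    (λ G free → upper-arith (suc k) m ((3 + m) C 4) (e42 G) 6K≤m (24*C4 m) (54*e42≤n⁴ G free)) ,
    tripartite κ , tripartite-free κ ,
    lower-arith (suc k) m ((3 + m) C 4) (e42 (tripartite κ)) 6K≤m (24*C4 m)
      (tripartite-arith m (hits (# 0) κ ⊤) (hits (# 1) κ ⊤) (hits (# 2) κ ⊤) (e42 (tripartite κ))
        (trans (sym (∣∣-hits κ ⊤)) (∣⊤∣≡n (3 + m)))
        (balanced-hits (3 + m) (# 0)) (balanced-hits (3 + m) (# 1)) (balanced-hits (3 + m) (# 2)) (e42-tripartite κ))
    where κ = balanced (3 + m)
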